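{- Let $A$ be a finite alphabet, $p$ a prime, $u\in A^*$ a non-empty word, and $\mathfrak{M}\in\mathbb{F}_p[q]$ a polynomial of degree at least $1$. Define the relation $\equiv_{u,\mathfrak{M}}$ on $A^*$ by $w_1\equiv_{u,\mathfrak{M}}w_2$ if (i) $w_1\sim_{u,\mathfrak{M}}w_2$; and (ii) $q^{|w_1|}\equiv q^{|w_2|}\pmod{\mathfrak{M}}$; and (iii) $|w_1|=|w_2|$, or $\operatorname{val}\left(\binom{w_i}{v}_q\right)+|w_i|-|v|\ge\operatorname{val}(\mathfrak{M})$ for all $i\in\{1,2\}$ and all $v\in A^*$ such that $av\in\operatorname{Fac}(u)$ for some $a\in A$. Then $\equiv_{u,\mathfrak{M}}$ is a congruence on $A^*$. Moreover, it is the coarsest congruence refining $\sim_{u,\mathfrak{M}}$.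
   Context: $A^*$ is the free monoid of finite words over $A$ (with concatenation and empty word $\varepsilon$), and $|w|$ is the length of a word $w$. The $q$-binomial coefficient $\binom{u}{v}_q\in\mathbb{N}[q]$ of two words $u,v\in A^*$ is defined recursively by $\binom{u}{\varepsilon}_q=1$, $\binom{\varepsilon}{v}_q=0$ if $v\neq\varepsilon$, and, for all $u,v\in A^*$ and letters $a,b\in A$, $\binom{ua}{vb}_q=q^{|vb|}\binom{u}{vb}_q+\delta_{a,b}\binom{u}{v}_q$, where $\delta_{a,b}$ is the Kronecker delta. The integer coefficients of $\binom{u}{v}_q$ are reduced modulo $p$ to view it in $\mathbb{F}_p[q]$. $\operatorname{Fac}(u)$ is the set of factors of $u$, i.e. the words $f$ with $u=xfs$ for some $x,s\in A^*$. Write $w_1\sim_{u,\mathfrak{M}}w_2$ if $\binom{w_1}{v}_q\equiv\binom{w_2}{v}_q\pmod{\mathfrak{M}}$ for all $v\in\operatorname{Fac}(u)$. For $\mathfrak{P}\in\mathbb{F}_p[q]$, $\operatorname{val}(\mathfrak{P})$ is the largest $\ell$ such that $q^\ell$ divides $\mathfrak{P}$, with $\operatorname{val}(0)=+\infty$. A congruence on $A^*$ is an equivalence relation compatible with concatenation on both sides. An equivalence relation $\cong$ refines $\sim$ (and $\sim$ is coarser than $\cong$) if $w_1\cong w_2$ implies $w_1\sim w_2$. "Coarsest" means: it is a congruence refining $\sim_{u,\mathfrak{M}}$, and every congruence refining $\sim_{u,\mathfrak{M}}$ refines it. -}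

module Defs where

open import Algebra.Bundles.Raw using (RawSemiring; RawRing)
import Algebra.Definitions as AlgebraicDefinitions
import Algebra.Definitions.RawMagma as RawMagmaDefinitions
open import Data.Bool.Base using (if_then_else_)
open import Data.Fin.Base using (Fin)
open import Data.Fin.Properties using (inj⇒≟)
open import Data.Integer.Base as ℤ using (ℤ; +_; 0ℤ; 1ℤ)
import Data.Integer.Divisibility.Signed as ℤ
import Data.Integer.Properties as ℤ
open import Data.List.Base
  using (List; []; _∷_; _++_; _∷ʳ_; map; drop; length; replicate; reverse)
open import Data.List.Properties using (reverse-++; length-reverse)
open import Data.Nat.Base as ℕ using (ℕ; zero; suc; _≤_; _<_; z≤n; s≤s)
import Data.Nat.Properties as ℕ
open import Data.Product.Base using (_×_; ∃₂)
open import Data.Sum.Base using (_⊎_)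
open import Function.Bundles using (_↔_; _⇔_; mk⇔)
open import Function.Properties.Inverse using (↔⇒↣)
open import Level using (Level; 0ℓ; _⊔_) renaming (suc to lsuc)
open import Relation.Binary.Core using (Rel; _⇒_)
open import Relation.Binary.Construct.Add.Supremum.NonStrict _≤_ using (_≤⁺_; _≤⊤⁺; [_])
open import Relation.Binary.Definitions using (DecidableEquality)
open import Relation.Binary.PropositionalEquality
  using (_≡_; refl; sym; trans; cong; cong₂; subst)
open import Relation.Binary.Structures using (IsEquivalence)
open import Relation.Nullary.Construct.Add.Supremum using (_⁺; ⊤⁺; [_])
open import Relation.Nullary.Decidable.Core using (does; yes; no)
open import Relation.Nullary.Negation.Core using (¬_; contradiction)

-- A polynomial is its list of coefficients, constant term first.
-- Trailing zeros are allowed, so equality is coefficientwise.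
module Polynomial {c ℓ : Level} (S : RawSemiring c ℓ) where
  open RawSemiring S

  Poly : Set c
  Poly = List Carrier

  coeff : Poly → ℕ → Carrier
  coeff []      _       = 0#
  coeff (a ∷ P) zero    = a
  coeff (a ∷ P) (suc n) = coeff P n

  infix  4 _≈ₚ_
  infixl 6 _+ₚ_
  infixl 7 _*ₚ_
  infixr 7 _·ₚ_
  infix  8 q^_

  _≈ₚ_ : Rel Poly ℓ
  P ≈ₚ Q = ∀ n → coeff P n ≈ coeff Q n

  _+ₚ_ : Poly → Poly → Poly
  []      +ₚ Q       = Q
  (a ∷ P) +ₚ []      = a ∷ P
  (a ∷ P) +ₚ (b ∷ Q) = (a + b) ∷ (P +ₚ Q)

  _·ₚ_ : Carrier → Poly → Poly
  a ·ₚ P = map (a *_) P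

  _*ₚ_ : Poly → Poly → Poly
  []      *ₚ Q = []
  (a ∷ P) *ₚ Q = a ·ₚ Q +ₚ (0# ∷ (P *ₚ Q))

  q^_ : ℕ → Poly
  q^ k = replicate k 0# ++ 1# ∷ []

  -- The zero polynomial has no degree.
  HasDegree : Poly → ℕ → Set ℓ
  HasDegree P d = ¬ (coeff P d ≈ 0#) × (∀ n → d < n → coeff P n ≈ 0#)

  poly-rawSemiring : RawSemiring c ℓ
  poly-rawSemiring = record
    { Carrier = Poly
    ; _≈_     = _≈ₚ_
    ; _+_     = _+ₚ_
    ; _*_     = _*ₚ_
    ; 0#      = []
    ; 1#      = 1# ∷ []
    }

  open RawMagmaDefinitions (RawSemiring.*-rawMagma poly-rawSemiring) public
    using () renaming (_∣_ to _∣ₚ_; _,_ to dividesₚ)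

module ℕ[q] = Polynomial ℕ.+-*-rawSemiring

ℕ[q] : Set
ℕ[q] = ℕ[q].Poly

-- 𝔽ₚ as the setoid of integers modulo p.
𝔽 : ℕ → RawRing 0ℓ 0ℓ
𝔽 p = record
  { Carrier = ℤ
  ; _≈_     = λ a b → + p ℤ.∣ a ℤ.- b
  ; _+_     = ℤ._+_
  ; _*_     = ℤ._*_
  ; -_      = ℤ.-_
  ; 0#      = 0ℤ
  ; 1#      = 1ℤ
  }

infixl 6 _∔_

_∔_ : ℕ ⁺ → ℕ → ℕ ⁺
[ m ] ∔ n = [ m ℕ.+ n ]
⊤⁺    ∔ n = ⊤⁺

module 𝔽[q] (p : ℕ) where
  open Polynomial (RawRing.rawSemiring (𝔽 p)) public

  infixl 6 _-ₚ_

  _-ₚ_ : Poly → Poly → Poly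
  P -ₚ Q = P +ₚ map ℤ.-_ Q

  _≡_[mod_] : Poly → Poly → Poly → Set
  P ≡ Q [mod M ] = M ∣ₚ P -ₚ Q

  reduce : ℕ[q] → Poly
  reduce = map +_

  -- The number of leading zero coefficients, with ⊤⁺ for +∞.
  val : Poly → ℕ ⁺
  val []      = ⊤⁺
  val (a ∷ P) with + p ℤ.∣? a ℤ.- 0ℤ
  ... | yes _ = val P ∔ 1
  ... | no _  = [ 0 ]

module QBinomial {a : Level} {A : Set a} (_≟_ : DecidableEquality A) where
  open ℕ[q]

  δ : A → A → ℕ
  δ a b = if does (a ≟ b) then 1 else 0

  -- The recursion removes last letters, so it runs on reversed words.
  -- The recurrence in terms of the words themselves is proved below.
  binomʳ : List A → List A → ℕ[q]
  binomʳ _       []      = 1 ∷ []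
  binomʳ []      (_ ∷ _) = []
  binomʳ (a ∷ u) (b ∷ v) =
    q^ length (b ∷ v) *ₚ binomʳ u (b ∷ v) +ₚ δ a b ·ₚ binomʳ u v

  binom : List A → List A → ℕ[q]
  binom u v = binomʳ (reverse u) (reverse v)

  binom-[] : ∀ u → binom u [] ≡ 1 ∷ []
  binom-[] u with reverse u
  ... | []    = refl
  ... | _ ∷ _ = refl

  []-binom-∷ʳ : ∀ v b → binom [] (v ∷ʳ b) ≡ []
  []-binom-∷ʳ v b rewrite reverse-++ v (b ∷ []) = refl

  binom-∷ʳ : ∀ u v a b →
    binom (u ∷ʳ a) (v ∷ʳ b)
      ≡ q^ length (v ∷ʳ b) *ₚ binom u (v ∷ʳ b) +ₚ δ a b ·ₚ binom u v
  binom-∷ʳ u v a b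
    rewrite sym (length-reverse (v ∷ʳ b))
          | reverse-++ u (a ∷ [])
          | reverse-++ v (b ∷ [])
          = refl

module _ {a : Level} {A : Set a} where

  Factor : List A → List A → Set a
  Factor u f = ∃₂ λ x s → u ≡ x ++ f ++ s

  record IsCongruence {ℓ : Level} (_~_ : Rel (List A) ℓ) : Set (a ⊔ ℓ) where
    open AlgebraicDefinitions _~_ using (LeftCongruent; RightCongruent)
    field
      isEquivalence : IsEquivalence _~_
      ++-congˡ      : LeftCongruent _++_
      ++-congʳ      : RightCongruent _++_

  -- Competing congruences range over relations valued in Set ℓ.
  record IsCoarsestCongruenceRefining
      {ℓ₁ ℓ₂ : Level} (ℓ : Level) (_~_ : Rel (List A) ℓ₁) (_≅_ : Rel (List A) ℓ₂)
      : Set (a ⊔ ℓ₁ ⊔ ℓ₂ ⊔ lsuc ℓ) where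
    field
      isCongruence : IsCongruence _≅_
      refines      : _≅_ ⇒ _~_
      coarsest     : (R : Rel (List A) ℓ) → IsCongruence R → R ⇒ _~_ → R ⇒ _≅_

module WordRelations {a : Level} {A : Set a} {k : ℕ} (finite : A ↔ Fin k) (p : ℕ) where
  open 𝔽[q] p
  open QBinomial (inj⇒≟ (↔⇒↣ finite)) public

  binomₚ : List A → List A → Poly
  binomₚ w v = reduce (binom w v)

  _∼[_,_]_ : List A → List A → Poly → List A → Set a
  w₁ ∼[ u , M ] w₂ = ∀ v → Factor u v → binomₚ w₁ v ≡ binomₚ w₂ v [mod M ]

  -- val (binom w v) + |w| - |v| ≥ val M, with |v| moved to the other
  -- side so that all terms stay in ℕ ∪ {+∞}.
  LargeVal : List A → Poly → List A → Set a
  LargeVal u M w = ∀ v a → Factor u (a ∷ v) →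
    val M ∔ length v ≤⁺ val (binomₚ w v) ∔ length w

  _≅[_,_]_ : List A → List A → Poly → List A → Set a
  w₁ ≅[ u , M ] w₂ =
      w₁ ∼[ u , M ] w₂
    × (q^ length w₁) ≡ (q^ length w₂) [mod M ]
    × (length w₁ ≡ length w₂ ⊎ (LargeVal u M w₁ × LargeVal u M w₂))

module ValProperties (p : ℕ) where
  open 𝔽[q] p

  _≈0 : ℤ → Set
  x ≈0 = + p ℤ.∣ x ℤ.- 0ℤ

  coeff-+ : ∀ P Q n → coeff (P +ₚ Q) n ≡ coeff P n ℤ.+ coeff Q n
  coeff-+ []      Q       n       = sym (ℤ.+-identityˡ _)
  coeff-+ (a ∷ P) []      n       = sym (ℤ.+-identityʳ _)
  coeff-+ (a ∷ P) (b ∷ Q) zero    = refl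
  coeff-+ (a ∷ P) (b ∷ Q) (suc n) = coeff-+ P Q n

  coeff-· : ∀ r P n → coeff (r ·ₚ P) n ≡ r ℤ.* coeff P n
  coeff-· r []      n       = sym (ℤ.*-zeroʳ r)
  coeff-· r (a ∷ P) zero    = refl
  coeff-· r (a ∷ P) (suc n) = coeff-· r P n

  coeff-q^-< : ∀ {m n} → n < m → coeff (q^ m) n ≡ 0ℤ
  coeff-q^-< {n = zero}  (s≤s _)   = refl
  coeff-q^-< {n = suc n} (s≤s n<m) = coeff-q^-< n<m

  coeff-q^-≡ : ∀ m → coeff (q^ m) m ≡ 1ℤ
  coeff-q^-≡ zero    = refl
  coeff-q^-≡ (suc m) = coeff-q^-≡ m

  coeff-q^-> : ∀ m n → coeff (q^ m) (suc (m ℕ.+ n)) ≡ 0ℤ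
  coeff-q^-> zero    n = refl
  coeff-q^-> (suc m) n = coeff-q^-> m n

  coeff-∷* : ∀ r R m n → coeff ((r ∷ R) *ₚ q^ m) n
    ≡ r ℤ.* coeff (q^ m) n ℤ.+ coeff (0ℤ ∷ (R *ₚ q^ m)) n
  coeff-∷* r R m n = trans (coeff-+ (r ·ₚ q^ m) _ n)
    (cong (ℤ._+ coeff (0ℤ ∷ (R *ₚ q^ m)) n) (coeff-· r (q^ m) n))

  r*0+ : ∀ r {x y z} → x ≡ 0ℤ → y ≡ z → r ℤ.* x ℤ.+ y ≡ z
  r*0+ r refl refl = trans (cong (ℤ._+ _) (ℤ.*-zeroʳ r)) (ℤ.+-identityˡ _)

  coeff-*q^-< : ∀ R {m n} → n < m → coeff (R *ₚ q^ m) n ≡ 0ℤ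
  coeff-*q^-< [] _ = refl
  coeff-*q^-< (r ∷ R) {m} {zero} n<m =
    trans (coeff-∷* r R m 0) (r*0+ r (coeff-q^-< n<m) refl)
  coeff-*q^-< (r ∷ R) {m} {suc n} n<m =
    trans (coeff-∷* r R m (suc n))
      (r*0+ r (coeff-q^-< n<m) (coeff-*q^-< R (ℕ.<-trans (ℕ.n<1+n n) n<m)))

  coeff-0∷ : ∀ R m → coeff (0ℤ ∷ (R *ₚ q^ m)) m ≡ 0ℤ
  coeff-0∷ R zero    = refl
  coeff-0∷ R (suc m) = coeff-*q^-< R (ℕ.n<1+n m)

  coeff-*q^-≥ : ∀ R m n → coeff (R *ₚ q^ m) (m ℕ.+ n) ≡ coeff R n
  coeff-*q^-≥ [] m n = refl
  coeff-*q^-≥ (r ∷ R) m zero rewrite ℕ.+-identityʳ m =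
    trans (coeff-∷* r R m m)
      (trans (cong₂ (λ x y → r ℤ.* x ℤ.+ y) (coeff-q^-≡ m) (coeff-0∷ R m))
        (trans (ℤ.+-identityʳ _) (ℤ.*-identityʳ r)))
  coeff-*q^-≥ (r ∷ R) m (suc n) rewrite ℕ.+-suc m n =
    trans (coeff-∷* r R m (suc (m ℕ.+ n)))
      (r*0+ r (coeff-q^-> m n) (coeff-*q^-≥ R m n))

  coeff-drop : ∀ m P n → coeff (drop m P) n ≡ coeff P (m ℕ.+ n)
  coeff-drop zero    P       n = refl
  coeff-drop (suc m) []      n = refl
  coeff-drop (suc m) (a ∷ P) n = coeff-drop m P n

  LowZero : ℕ → Poly → Set
  LowZero m P = ∀ n → n < m → coeff P n ≈0

  -‿≈0 : ∀ {x y} → x ≡ y → + p ℤ.∣ x ℤ.- y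
  -‿≈0 {x} refl = ℤ.divides 0ℤ (ℤ.+-inverseʳ x)

  0-x≡-[x-0] : ∀ x → 0ℤ ℤ.- x ≡ ℤ.- (x ℤ.- 0ℤ)
  0-x≡-[x-0] x = trans (ℤ.+-identityˡ _) (cong ℤ.-_ (sym (ℤ.+-identityʳ x)))

  0≈x⇒x≈0 : ∀ x → + p ℤ.∣ 0ℤ ℤ.- x → x ≈0
  0≈x⇒x≈0 x p∣ = subst (+ p ℤ.∣_) (ℤ.neg-involutive (x ℤ.- 0ℤ))
    (ℤ.∣m⇒∣-m (subst (+ p ℤ.∣_) (0-x≡-[x-0] x) p∣))

  x≈0⇒0≈x : ∀ x → x ≈0 → + p ℤ.∣ 0ℤ ℤ.- x
  x≈0⇒0≈x x p∣ = subst (+ p ℤ.∣_) (sym (0-x≡-[x-0] x)) (ℤ.∣m⇒∣-m p∣)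

  ∣⇒lowZero : ∀ {m P} → q^ m ∣ₚ P → LowZero m P
  ∣⇒lowZero {m} {P} (dividesₚ R eq) n n<m = 0≈x⇒x≈0 (coeff P n)
    (subst (λ x → + p ℤ.∣ x ℤ.- coeff P n) (coeff-*q^-< R n<m) (eq n))

  lowZero⇒∣ : ∀ {m P} → LowZero m P → q^ m ∣ₚ P
  lowZero⇒∣ {m} {P} low = dividesₚ (drop m P) eq
    where
    eq : drop m P *ₚ q^ m ≈ₚ P
    eq n with n ℕ.<? m
    ... | yes n<m = subst (λ x → + p ℤ.∣ x ℤ.- coeff P n)
            (sym (coeff-*q^-< (drop m P) n<m)) (x≈0⇒0≈x (coeff P n) (low n n<m))
    ... | no n≮m = -‿≈0 (subst (λ i → coeff (drop m P *ₚ q^ m) i ≡ coeff P i)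
            (ℕ.m+[n∸m]≡n (ℕ.≮⇒≥ n≮m))
            (trans (coeff-*q^-≥ (drop m P) m (n ℕ.∸ m)) (coeff-drop m P (n ℕ.∸ m))))

  suc-≤⁺ : ∀ {m x} → [ m ] ≤⁺ x → [ suc m ] ≤⁺ x ∔ 1
  suc-≤⁺ {m} ([_] {l = l} m≤l) = [ subst (suc m ≤_) (ℕ.+-comm 1 l) (s≤s m≤l) ]
  suc-≤⁺ (_ ≤⊤⁺) = _ ≤⊤⁺

  pred-≤⁺ : ∀ {m} x → [ suc m ] ≤⁺ x ∔ 1 → [ m ] ≤⁺ x
  pred-≤⁺ {m} [ l ] [ le ] = [ ℕ.s≤s⁻¹ (subst (suc m ≤_) (ℕ.+-comm l 1) le) ]
  pred-≤⁺ ⊤⁺ _ = _ ≤⊤⁺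

  0≤⁺ : ∀ x → [ 0 ] ≤⁺ x
  0≤⁺ [ _ ] = [ z≤n ]
  0≤⁺ ⊤⁺    = _ ≤⊤⁺

  lowZero⇒≤val : ∀ m P → LowZero m P → [ m ] ≤⁺ val P
  lowZero⇒≤val zero    P       low = 0≤⁺ (val P)
  lowZero⇒≤val (suc m) []      low = _ ≤⊤⁺
  lowZero⇒≤val (suc m) (a ∷ P) low with + p ℤ.∣? a ℤ.- 0ℤ
  ... | yes _  = suc-≤⁺ (lowZero⇒≤val m P (λ n n<m → low (suc n) (s≤s n<m)))
  ... | no a≉0 = contradiction (low 0 (s≤s z≤n)) a≉0

  ≤val⇒lowZero : ∀ m P → [ m ] ≤⁺ val P → LowZero m P
  ≤val⇒lowZero m       []      _  n       _ = -‿≈0 {0ℤ} refl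
  ≤val⇒lowZero (suc m) (a ∷ P) le n n<m with + p ℤ.∣? a ℤ.- 0ℤ | le | n | n<m
  ... | yes a≈0 | _    | zero   | _       = a≈0
  ... | yes _   | le′  | suc n′ | s≤s n<m = ≤val⇒lowZero m P (pred-≤⁺ (val P) le′) n′ n<m
  ... | no _    | [ () ] | _    | _

  -- val P is the largest ℓ such that q^ ℓ divides P, and +∞ exactly for P ≈ₚ 0.
  q^∣⇔≤val : ∀ m P → q^ m ∣ₚ P ⇔ [ m ] ≤⁺ val P
  q^∣⇔≤val m P = mk⇔
    (λ q^m∣P → lowZero⇒≤val m P (∣⇒lowZero q^m∣P))
    (λ m≤val → lowZero⇒∣ (≤val⇒lowZero m P m≤val))

{-# OPTIONS --safe #-}

-- Write m = val M and S(w,v) = q^(|w|-|v|) binom(w,v), so that condition (iii)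
-- says that q^m divides S(wᵢ,v) or that the lengths agree. The recurrence at the
-- first letter, binom(aw,bv) = binom(w,bv) + δ(a,b) S(w,v), shows that stability
-- under left concatenation amounts to S(w₁,v) ≡ S(w₂,v) mod M whenever bv is a
-- factor of u. This follows from (i)-(iii): multiplied by q^|v| the congruence
-- comes from (i) and (ii), and the factor q^|v| can be cancelled since both sides
-- are divisible by q^m, the only part of M not coprime to q.
-- Conversely, prepending b shows that a congruence refining ∼ preserves S(_,v)
-- mod M. The case v = [] is (ii). If |w₁| < |w₂|, then modulo q^m we get
-- S(w₁,v) ≡ S(w₂,v) ≡ q^(|w₂|-|w₁|) S(w₁,v), and 1 - q^(|w₂|-|w₁|) is a unit,
-- so q^m divides both S(wᵢ,v), which is (iii).
module Submission where

open import Defs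
open import Data.Bool.Base using (if_then_else_)
open import Data.Fin.Base using (Fin)
open import Data.Fin.Properties using (inj⇒≟)
open import Data.Integer.Base as ℤ using (ℤ; +_; 0ℤ; 1ℤ; -1ℤ)
import Data.Integer.Divisibility.Signed as ℤ
import Data.Integer.Properties as ℤ
open import Data.Integer.Tactic.RingSolver using (solve-∀)
open import Data.List.Base
  using (List; []; _∷_; _++_; _∷ʳ_; map; length; reverse; _∷ʳ′_; initLast)
open import Data.List.Properties
  using (++-assoc; ++-identityʳ; reverse-++; length-reverse; length-++; unfold-reverse)
open import Data.Nat.Base as ℕ using (ℕ; zero; suc; _≤_; _<_; _∸_; z≤n; s≤s)
import Data.Nat.Divisibility as ℕ
open import Data.Nat.Primality using (Prime; euclidsLemma)
import Data.Nat.Properties as ℕ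
open import Data.Product.Base using (_×_; _,_; proj₁; proj₂; ∃; swap) renaming (map to map×)
open import Data.Sum.Base using (_⊎_; inj₁; inj₂; map₂) renaming (map to map⊎)
open import Function.Base using (_∘_)
open import Function.Bundles using (_↔_)
open import Function.Properties.Inverse using (↔⇒↣)
open import Level using (Level)
open import Relation.Binary.Bundles using (Setoid)
open import Relation.Binary.Construct.Add.Supremum.NonStrict ℕ._≤_ using (_≤⁺_; _≤⊤⁺; [_])
open import Relation.Binary.Core using (Rel)
open import Relation.Binary.Definitions using (DecidableEquality; tri<; tri≈; tri>)
open import Relation.Binary.PropositionalEquality
  using (_≡_; _≢_; _≗_; refl; sym; trans; cong; cong₂; subst; subst₂; module ≡-Reasoning)
import Relation.Binary.Reasoning.Setoid as SetoidReasoning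
open import Relation.Binary.Structures using (IsEquivalence)
open import Relation.Nullary.Construct.Add.Supremum using (⊤⁺; [_])
open import Relation.Nullary.Decidable using (yes; no; dec-true)
open import Relation.Nullary.Negation.Core using (¬_; contradiction)

-- Coefficient sequences and multiplication by powers of q

Sequence : Set
Sequence = ℕ → ℤ

delay : Sequence → Sequence
delay f zero    = 0ℤ
delay f (suc n) = f n

-- Multiplication by q^k on coefficients; `delay` is the case of q itself. Working with functions
-- makes trailing zeros of coefficient lists irrelevant.
shift : ℕ → Sequence → Sequence
shift zero    f = f
shift (suc k) f = delay (shift k f)

delay-cong : ∀ {f g} → f ≗ g → delay f ≗ delay g
delay-cong f≗g zero    = refl
delay-cong f≗g (suc n) = f≗g n

shift-cong : ∀ k {f g} → f ≗ g → shift k f ≗ shift k g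
shift-cong zero    f≗g = f≗g
shift-cong (suc k) f≗g = delay-cong (shift-cong k f≗g)

delay-map : ∀ h → h 0ℤ ≡ 0ℤ → ∀ f → delay (h ∘ f) ≗ h ∘ delay f
delay-map h h0 f zero    = sym h0
delay-map h h0 f (suc n) = refl

shift-map : ∀ h → h 0ℤ ≡ 0ℤ → ∀ k f → shift k (h ∘ f) ≗ h ∘ shift k f
shift-map h h0 zero    f n = refl
shift-map h h0 (suc k) f n =
  trans (delay-cong (shift-map h h0 k f) n) (delay-map h h0 (shift k f) n)

delay-zipWith : ∀ (_∙_ : ℤ → ℤ → ℤ) → 0ℤ ∙ 0ℤ ≡ 0ℤ → ∀ f g →
  delay (λ i → f i ∙ g i) ≗ λ i → delay f i ∙ delay g i
delay-zipWith _∙_ 0∙0 f g zero    = sym 0∙0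
delay-zipWith _∙_ 0∙0 f g (suc n) = refl

shift-zipWith : ∀ (_∙_ : ℤ → ℤ → ℤ) → 0ℤ ∙ 0ℤ ≡ 0ℤ → ∀ k f g →
  shift k (λ i → f i ∙ g i) ≗ λ i → shift k f i ∙ shift k g i
shift-zipWith _∙_ 0∙0 zero    f g n = refl
shift-zipWith _∙_ 0∙0 (suc k) f g n =
  trans (delay-cong (shift-zipWith _∙_ 0∙0 k f g) n)
        (delay-zipWith _∙_ 0∙0 (shift k f) (shift k g) n)

shift-0 : ∀ k {f} → (∀ n → f n ≡ 0ℤ) → ∀ n → shift k f n ≡ 0ℤ
shift-0 zero    f≡0 n       = f≡0 n
shift-0 (suc k) f≡0 zero    = refl
shift-0 (suc k) f≡0 (suc n) = shift-0 k f≡0 n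

shift-+ : ∀ j k f → shift (j ℕ.+ k) f ≗ shift j (shift k f)
shift-+ zero    k f n = refl
shift-+ (suc j) k f n = delay-cong (shift-+ j k f) n

shift-delay : ∀ k f → shift k (delay f) ≗ delay (shift k f)
shift-delay zero    f n = refl
shift-delay (suc k) f n = delay-cong (shift-delay k f) n

shift-lookup : ∀ k f n → shift k f (k ℕ.+ n) ≡ f n
shift-lookup zero    f n = refl
shift-lookup (suc k) f n = shift-lookup k f n

-- Integers modulo p and divisibility by powers of q

module Residues (p : ℕ) where
  open ValProperties p using (-‿≈0)

  infix 4 _≈_

  -- A record, so that `x` and `y` can be inferred: they cannot be read off from the divisibility of
  -- a difference.
  record _≈_ (x y : ℤ) : Set where
    constructor mod
    field p∣x-y : + p ℤ.∣ x ℤ.- y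
  open _≈_ public

  ≈-reflexive : ∀ {x y} → x ≡ y → x ≈ y
  ≈-reflexive x≡y = mod (-‿≈0 x≡y)

  ≈-sym : ∀ {x y} → x ≈ y → y ≈ x
  ≈-sym {x} {y} (mod d) = mod (subst (+ p ℤ.∣_) (lemma x y) (ℤ.∣m⇒∣-m d))
    where
    lemma : ∀ x y → ℤ.- (x ℤ.- y) ≡ y ℤ.- x
    lemma = solve-∀

  ≈-trans : ∀ {x y z} → x ≈ y → y ≈ z → x ≈ z
  ≈-trans {x} {y} {z} (mod d) (mod e) =
    mod (subst (+ p ℤ.∣_) (lemma x y z) (ℤ.∣m∣n⇒∣m+n d e))
    where
    lemma : ∀ x y z → (x ℤ.- y) ℤ.+ (y ℤ.- z) ≡ x ℤ.- z
    lemma = solve-∀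

  ≈-setoid : Setoid _ _
  ≈-setoid = record
    { Carrier       = ℤ
    ; _≈_           = _≈_
    ; isEquivalence = record { refl = ≈-reflexive refl ; sym = ≈-sym ; trans = ≈-trans }
    }

  module ≈-Reasoning = SetoidReasoning ≈-setoid

  +-cong : ∀ {x x′ y y′} → x ≈ x′ → y ≈ y′ → x ℤ.+ y ≈ x′ ℤ.+ y′
  +-cong {x} {x′} {y} {y′} (mod d) (mod e) =
    mod (subst (+ p ℤ.∣_) (lemma x x′ y y′) (ℤ.∣m∣n⇒∣m+n d e))
    where
    lemma : ∀ x x′ y y′ → (x ℤ.- x′) ℤ.+ (y ℤ.- y′) ≡ (x ℤ.+ y) ℤ.- (x′ ℤ.+ y′)
    lemma = solve-∀

  *-congˡ : ∀ c {x y} → x ≈ y → c ℤ.* x ≈ c ℤ.* y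
  *-congˡ c {x} {y} (mod d) = mod (subst (+ p ℤ.∣_) (lemma c x y) (ℤ.∣n⇒∣m*n c d))
    where
    lemma : ∀ c x y → c ℤ.* (x ℤ.- y) ≡ c ℤ.* x ℤ.- c ℤ.* y
    lemma = solve-∀

  *-congʳ : ∀ c {x y} → x ≈ y → x ℤ.* c ≈ y ℤ.* c
  *-congʳ c {x} {y} x≈y = subst₂ _≈_ (ℤ.*-comm c x) (ℤ.*-comm c y) (*-congˡ c x≈y)

  x-y≈0⇒x≈y : ∀ {x y} → x ℤ.- y ≈ 0ℤ → x ≈ y
  x-y≈0⇒x≈y (mod d) = mod (subst (+ p ℤ.∣_) (ℤ.+-identityʳ _) d)

  x≈y⇒x-y≈0 : ∀ {x y} → x ≈ y → x ℤ.- y ≈ 0ℤ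
  x≈y⇒x-y≈0 (mod d) = mod (subst (+ p ℤ.∣_) (sym (ℤ.+-identityʳ _)) d)

  -- Primality of `p` enters here, through Euclid's lemma on absolute values.
  x*y≈0⇒x≈0 : Prime p → ∀ {x y} → x ℤ.* y ≈ 0ℤ → ¬ (y ≈ 0ℤ) → x ≈ 0ℤ
  x*y≈0⇒x≈0 p-prime {x} {y} (mod d) y≉0
    with euclidsLemma ℤ.∣ x ∣ ℤ.∣ y ∣ p-prime
           (subst (p ℕ.∣_) (trans (cong ℤ.∣_∣ (ℤ.+-identityʳ (x ℤ.* y))) (ℤ.abs-* x y))
             (ℤ.∣⇒∣ᵤ d))
  ... | inj₁ p∣x = mod (subst (+ p ℤ.∣_) (sym (ℤ.+-identityʳ x)) (ℤ.∣ᵤ⇒∣ p∣x))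
  ... | inj₂ p∣y = contradiction (mod (subst (+ p ℤ.∣_) (sym (ℤ.+-identityʳ y)) (ℤ.∣ᵤ⇒∣ p∣y))) y≉0

  -- Divisibility by q^m modulo `p`, read on coefficients.
  VanishesBelow : ℕ → Sequence → Set
  VanishesBelow m f = ∀ n → n < m → f n ≈ 0ℤ

  vanishes-+ : ∀ {m f g} → VanishesBelow m f → VanishesBelow m g →
    VanishesBelow m (λ n → f n ℤ.+ g n)
  vanishes-+ f≈0 g≈0 n n<m = +-cong (f≈0 n n<m) (g≈0 n n<m)

  vanishes-* : ∀ c {m f} → VanishesBelow m f → VanishesBelow m (λ n → c ℤ.* f n)
  vanishes-* c f≈0 n n<m =
    ≈-trans (*-congˡ c (f≈0 n n<m)) (≈-reflexive (ℤ.*-zeroʳ c))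

  vanishes-delay : ∀ {m f} → VanishesBelow m f → VanishesBelow (suc m) (delay f)
  vanishes-delay f≈0 zero    _         = ≈-reflexive refl
  vanishes-delay f≈0 (suc n) (s≤s n<m) = f≈0 n n<m

  -- The hypothesis bounds `n ℕ.+ k` instead of using `m ∸ k`, so it is simply vacuous when `k` is
  -- at least `m`.
  vanishes-shift : ∀ k {m f} →
    (∀ n → n ℕ.+ k < m → f n ≈ 0ℤ) → VanishesBelow m (shift k f)
  vanishes-shift zero    f≈0 n       n<m       = f≈0 n (subst (_< _) (sym (ℕ.+-identityʳ n)) n<m)
  vanishes-shift (suc k) f≈0 zero    _         = ≈-reflexive refl
  vanishes-shift (suc k) {suc m} f≈0 (suc n) (s≤s n<m) =
    vanishes-shift k (λ i i+k<m → f≈0 i (subst (_< suc m) (sym (ℕ.+-suc i k)) (s≤s i+k<m))) n n<m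

  -- The entry of a shifted sequence at `n` is either 0 or an entry of `f` at an index at most `n`.
  shift-vanishes : ∀ j {f} n → (∀ i → i ≤ n → f i ≈ 0ℤ) → shift j f n ≈ 0ℤ
  shift-vanishes j n f≈0 = vanishes-shift j
    (λ i i+j≤n → f≈0 i (ℕ.≤-trans (ℕ.m≤m+n i j) (ℕ.s≤s⁻¹ i+j≤n))) n (ℕ.n<1+n n)

  +*-vanishes : ∀ c {x y} → x ≈ 0ℤ → y ≈ 0ℤ → x ℤ.+ c ℤ.* y ≈ 0ℤ
  +*-vanishes c x≈0 y≈0 = +-cong x≈0 (≈-trans (*-congˡ c y≈0) (≈-reflexive (ℤ.*-zeroʳ c)))

  -- In 𝔽ₚ[q]/(q^m) the element 1 - q^(k+1) is a unit.
  vanishes-geometric : ∀ k m {f} →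
    (∀ n → n < m → f n ≈ shift (suc k) f n) → VanishesBelow m f
  vanishes-geometric k zero    f≈ n ()
  vanishes-geometric k (suc m) f≈ n n<1+m =
    ≈-trans (f≈ n n<1+m)
      (vanishes-delay
        (vanishes-shift k λ i i+k<m → low i (ℕ.≤-<-trans (ℕ.m≤m+n i k) i+k<m)) n n<1+m)
    where
    low = vanishes-geometric k m (λ i i<m → f≈ i (ℕ.m<n⇒m<1+n i<m))

-- Congruence modulo M and cancellation of powers of q

module PolynomialCongruence (p : ℕ) (M : 𝔽[q].Poly p) where
  open 𝔽[q] p
  open ValProperties p using (coeff-+; coeff-·)
  open Residues p

  coeff-∷*ₚ : ∀ r R n →
    coeff ((r ∷ R) *ₚ M) n ≡ r ℤ.* coeff M n ℤ.+ delay (coeff (R *ₚ M)) n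
  coeff-∷*ₚ r R zero    = trans (coeff-+ (r ·ₚ M) _ 0) (cong (ℤ._+ 0ℤ) (coeff-· r M 0))
  coeff-∷*ₚ r R (suc n) =
    trans (coeff-+ (r ·ₚ M) _ (suc n)) (cong (ℤ._+ coeff (R *ₚ M) n) (coeff-· r M (suc n)))

  coeff-+*ₚ : ∀ R S n → coeff ((R +ₚ S) *ₚ M) n ≡ coeff (R *ₚ M) n ℤ.+ coeff (S *ₚ M) n
  coeff-+*ₚ []      S       n = sym (ℤ.+-identityˡ _)
  coeff-+*ₚ (r ∷ R) []      n = sym (ℤ.+-identityʳ _)
  coeff-+*ₚ (r ∷ R) (s ∷ S) n = begin
    coeff ((r ℤ.+ s ∷ R +ₚ S) *ₚ M) n
      ≡⟨ coeff-∷*ₚ (r ℤ.+ s) (R +ₚ S) n ⟩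
    (r ℤ.+ s) ℤ.* coeff M n ℤ.+ delay (coeff ((R +ₚ S) *ₚ M)) n
      ≡⟨ cong (λ x → (r ℤ.+ s) ℤ.* coeff M n ℤ.+ x)
           (trans (delay-cong (coeff-+*ₚ R S) n)
                  (delay-zipWith ℤ._+_ refl (coeff (R *ₚ M)) (coeff (S *ₚ M)) n)) ⟩
    (r ℤ.+ s) ℤ.* coeff M n ℤ.+ (delay (coeff (R *ₚ M)) n ℤ.+ delay (coeff (S *ₚ M)) n)
      ≡⟨ lemma r s (coeff M n) (delay (coeff (R *ₚ M)) n) _ ⟩
    (r ℤ.* coeff M n ℤ.+ delay (coeff (R *ₚ M)) n)
      ℤ.+ (s ℤ.* coeff M n ℤ.+ delay (coeff (S *ₚ M)) n)
      ≡⟨ cong₂ ℤ._+_ (coeff-∷*ₚ r R n) (coeff-∷*ₚ s S n) ⟨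
    coeff ((r ∷ R) *ₚ M) n ℤ.+ coeff ((s ∷ S) *ₚ M) n ∎
    where
    open ≡-Reasoning
    lemma : ∀ r s m x y → (r ℤ.+ s) ℤ.* m ℤ.+ (x ℤ.+ y) ≡ (r ℤ.* m ℤ.+ x) ℤ.+ (s ℤ.* m ℤ.+ y)
    lemma = solve-∀

  coeff-·*ₚ : ∀ c R n → coeff ((c ·ₚ R) *ₚ M) n ≡ c ℤ.* coeff (R *ₚ M) n
  coeff-·*ₚ c []      n = sym (ℤ.*-zeroʳ c)
  coeff-·*ₚ c (r ∷ R) n = begin
    coeff ((c ℤ.* r ∷ c ·ₚ R) *ₚ M) n
      ≡⟨ coeff-∷*ₚ (c ℤ.* r) (c ·ₚ R) n ⟩
    c ℤ.* r ℤ.* coeff M n ℤ.+ delay (coeff ((c ·ₚ R) *ₚ M)) n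
      ≡⟨ cong (λ x → c ℤ.* r ℤ.* coeff M n ℤ.+ x)
           (trans (delay-cong (coeff-·*ₚ c R) n)
                  (delay-map (c ℤ.*_) (ℤ.*-zeroʳ c) (coeff (R *ₚ M)) n)) ⟩
    c ℤ.* r ℤ.* coeff M n ℤ.+ c ℤ.* delay (coeff (R *ₚ M)) n
      ≡⟨ lemma c r (coeff M n) _ ⟩
    c ℤ.* (r ℤ.* coeff M n ℤ.+ delay (coeff (R *ₚ M)) n)
      ≡⟨ cong (c ℤ.*_) (coeff-∷*ₚ r R n) ⟨
    c ℤ.* coeff ((r ∷ R) *ₚ M) n ∎
    where
    open ≡-Reasoning
    lemma : ∀ c r m x → c ℤ.* r ℤ.* m ℤ.+ c ℤ.* x ≡ c ℤ.* (r ℤ.* m ℤ.+ x)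
    lemma = solve-∀

  infix 4 _≋_

  -- Congruence modulo `M` for arbitrary sequences, so that shifts and pointwise sums need no list
  -- form; only the quotient is a polynomial.
  record _≋_ (f g : Sequence) : Set where
    constructor multiple
    field
      quotient   : Poly
      difference : ∀ n → coeff (quotient *ₚ M) n ≈ f n ℤ.- g n

  ≈⇒≋ : ∀ {f g} → (∀ n → f n ≈ g n) → f ≋ g
  ≈⇒≋ f≈g = multiple [] (λ n → ≈-sym (x≈y⇒x-y≈0 (f≈g n)))

  ≗⇒≋ : ∀ {f g} → f ≗ g → f ≋ g
  ≗⇒≋ f≗g = ≈⇒≋ (≈-reflexive ∘ f≗g)

  ≋-+ : ∀ {f f′ g g′} → f ≋ f′ → g ≋ g′ → (λ n → f n ℤ.+ g n) ≋ (λ n → f′ n ℤ.+ g′ n)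
  ≋-+ {f} {f′} {g} {g′} (multiple R f-f′) (multiple S g-g′) = multiple (R +ₚ S) λ n → begin
    coeff ((R +ₚ S) *ₚ M) n                   ≡⟨ coeff-+*ₚ R S n ⟩
    coeff (R *ₚ M) n ℤ.+ coeff (S *ₚ M) n     ≈⟨ +-cong (f-f′ n) (g-g′ n) ⟩
    (f n ℤ.- f′ n) ℤ.+ (g n ℤ.- g′ n)         ≡⟨ lemma (f n) (f′ n) (g n) (g′ n) ⟩
    (f n ℤ.+ g n) ℤ.- (f′ n ℤ.+ g′ n)         ∎
    where
    open ≈-Reasoning
    lemma : ∀ x x′ y y′ → (x ℤ.- x′) ℤ.+ (y ℤ.- y′) ≡ (x ℤ.+ y) ℤ.- (x′ ℤ.+ y′)
    lemma = solve-∀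

  ≋-* : ∀ c {f g} → f ≋ g → (λ n → c ℤ.* f n) ≋ (λ n → c ℤ.* g n)
  ≋-* c {f} {g} (multiple R f-g) = multiple (c ·ₚ R) λ n → begin
    coeff ((c ·ₚ R) *ₚ M) n       ≡⟨ coeff-·*ₚ c R n ⟩
    c ℤ.* coeff (R *ₚ M) n        ≈⟨ *-congˡ c (f-g n) ⟩
    c ℤ.* (f n ℤ.- g n)           ≡⟨ lemma c (f n) (g n) ⟩
    c ℤ.* f n ℤ.- c ℤ.* g n       ∎
    where
    open ≈-Reasoning
    lemma : ∀ c x y → c ℤ.* (x ℤ.- y) ≡ c ℤ.* x ℤ.- c ℤ.* y
    lemma = solve-∀

  ≋-sym : ∀ {f g} → f ≋ g → g ≋ f
  ≋-sym {f} {g} (multiple R f-g) = multiple (-1ℤ ·ₚ R) λ n → begin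
    coeff ((-1ℤ ·ₚ R) *ₚ M) n     ≡⟨ coeff-·*ₚ -1ℤ R n ⟩
    -1ℤ ℤ.* coeff (R *ₚ M) n      ≈⟨ *-congˡ -1ℤ (f-g n) ⟩
    -1ℤ ℤ.* (f n ℤ.- g n)         ≡⟨ lemma (f n) (g n) ⟩
    g n ℤ.- f n                   ∎
    where
    open ≈-Reasoning
    lemma : ∀ x y → -1ℤ ℤ.* (x ℤ.- y) ≡ y ℤ.- x
    lemma = solve-∀

  ≋-trans : ∀ {f g h} → f ≋ g → g ≋ h → f ≋ h
  ≋-trans {f} {g} {h} (multiple R f-g) (multiple S g-h) = multiple (R +ₚ S) λ n → begin
    coeff ((R +ₚ S) *ₚ M) n                   ≡⟨ coeff-+*ₚ R S n ⟩
    coeff (R *ₚ M) n ℤ.+ coeff (S *ₚ M) n     ≈⟨ +-cong (f-g n) (g-h n) ⟩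
    (f n ℤ.- g n) ℤ.+ (g n ℤ.- h n)           ≡⟨ lemma (f n) (g n) (h n) ⟩
    f n ℤ.- h n                               ∎
    where
    open ≈-Reasoning
    lemma : ∀ x y z → (x ℤ.- y) ℤ.+ (y ℤ.- z) ≡ x ℤ.- z
    lemma = solve-∀

  ≋-setoid : Setoid _ _
  ≋-setoid = record
    { Carrier       = Sequence
    ; _≈_           = _≋_
    ; isEquivalence = record { refl = ≗⇒≋ (λ _ → refl) ; sym = ≋-sym ; trans = ≋-trans }
    }

  module ≋-Reasoning = SetoidReasoning ≋-setoid

  ≋-delay : ∀ {f g} → f ≋ g → delay f ≋ delay g
  ≋-delay {f} {g} (multiple R f-g) = multiple (0ℤ ∷ R) λ n →
    ≈-trans (≈-reflexive (trans (coeff-∷*ₚ 0ℤ R n) (ℤ.+-identityˡ _))) (delayed n)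
    where
    delayed : ∀ n → delay (coeff (R *ₚ M)) n ≈ delay f n ℤ.- delay g n
    delayed zero    = ≈-reflexive refl
    delayed (suc n) = f-g n

  ≋-shift : ∀ k {f g} → f ≋ g → shift k f ≋ shift k g
  ≋-shift zero    f≋g = f≋g
  ≋-shift (suc k) f≋g = ≋-delay (≋-shift k f≋g)

  -- This multiplies q^j ≡ q^k by a polynomial, one coefficient at a time: writing it as c + qQ, the
  -- constant c scales the given congruence, and the rest is the induction hypothesis times q.
  shift-≋⇒shift*-≋ : ∀ j k → shift j (coeff (1ℤ ∷ [])) ≋ shift k (coeff (1ℤ ∷ [])) →
    ∀ Q → shift j (coeff Q) ≋ shift k (coeff Q)
  shift-≋⇒shift*-≋ j k q^j≋q^k [] =
    ≗⇒≋ (λ n → trans (shift-0 j (λ _ → refl) n) (sym (shift-0 k (λ _ → refl) n)))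
  shift-≋⇒shift*-≋ j k q^j≋q^k (c ∷ Q) = begin
    shift j (coeff (c ∷ Q))                  ≈⟨ ≗⇒≋ (expand j) ⟩
    (λ n → c ℤ.* shift j one n ℤ.+ delay (shift j (coeff Q)) n)
      ≈⟨ ≋-+ (≋-* c q^j≋q^k) (≋-delay (shift-≋⇒shift*-≋ j k q^j≋q^k Q)) ⟩
    (λ n → c ℤ.* shift k one n ℤ.+ delay (shift k (coeff Q)) n)
                                             ≈⟨ ≗⇒≋ (expand k) ⟨
    shift k (coeff (c ∷ Q))                  ∎
    where
    open ≋-Reasoning
    one = coeff (1ℤ ∷ [])

    split : ∀ n → coeff (c ∷ Q) n ≡ c ℤ.* one n ℤ.+ delay (coeff Q) n
    split zero    = sym (trans (ℤ.+-identityʳ _) (ℤ.*-identityʳ c))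
    split (suc n) = sym (trans (cong (ℤ._+ coeff Q n) (ℤ.*-zeroʳ c)) (ℤ.+-identityˡ _))

    expand : ∀ i n → shift i (coeff (c ∷ Q)) n ≡ c ℤ.* shift i one n ℤ.+ delay (shift i (coeff Q)) n
    expand i n = trans (shift-cong i split n)
      (trans (shift-zipWith ℤ._+_ refl i _ _ n)
        (cong₂ ℤ._+_ (shift-map (c ℤ.*_) (ℤ.*-zeroʳ c) i one n) (shift-delay i (coeff Q) n)))

  coeff-- : ∀ P Q n → coeff (P -ₚ Q) n ≡ coeff P n ℤ.- coeff Q n
  coeff-- P Q n = trans (coeff-+ P (map ℤ.-_ Q) n) (cong (λ x → coeff P n ℤ.+ x) (coeff-neg Q n))
    where
    coeff-neg : ∀ Q n → coeff (map ℤ.-_ Q) n ≡ ℤ.- coeff Q n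
    coeff-neg []      n       = refl
    coeff-neg (a ∷ Q) zero    = refl
    coeff-neg (a ∷ Q) (suc n) = coeff-neg Q n

  mod⇒≋ : ∀ P Q → P ≡ Q [mod M ] → coeff P ≋ coeff Q
  mod⇒≋ P Q (dividesₚ R R*M≈P-Q) = multiple R λ n →
    ≈-trans (mod (R*M≈P-Q n)) (≈-reflexive (coeff-- P Q n))

  ≋⇒mod : ∀ P Q → coeff P ≋ coeff Q → P ≡ Q [mod M ]
  ≋⇒mod P Q (multiple R f-g) = dividesₚ R λ n →
    p∣x-y (≈-trans (f-g n) (≈-reflexive (sym (coeff-- P Q n))))

  module _ {m : ℕ} (M-low : VanishesBelow m (coeff M)) where

    *ₚ-low : ∀ R → VanishesBelow m (coeff (R *ₚ M))
    *ₚ-low []      n n<m = ≈-reflexive refl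
    *ₚ-low (r ∷ R) n n<m = ≈-trans (≈-reflexive (coeff-∷*ₚ r R n))
      (vanishes-+ (vanishes-* r M-low) (λ i i<m → vanishes-delay (*ₚ-low R) i (ℕ.m<n⇒m<1+n i<m)) n n<m)

    -- Since q^m divides `M`, a congruence modulo `M` is also one modulo q^m.
    ≋⇒≈-below : ∀ {f g} → f ≋ g → ∀ n → n < m → f n ≈ g n
    ≋⇒≈-below (multiple R f-g) n n<m =
      x-y≈0⇒x≈y (≈-trans (≈-sym (f-g n)) (*ₚ-low R n n<m))

    module _ (p-prime : Prime p) (Mₘ≉0 : ¬ (coeff M m ≈ 0ℤ)) where

      -- The cofactor of a multiple of M vanishing up to degree m has constant
      -- term 0, so one factor q can be cancelled.
      delay-cancel : ∀ {f g} → VanishesBelow m f → VanishesBelow m g →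
        delay f ≋ delay g → f ≋ g
      delay-cancel _ _ (multiple [] f-g) = ≈⇒≋ (λ n → x-y≈0⇒x≈y (≈-sym (f-g (suc n))))
      delay-cancel {f} {g} f-low g-low (multiple (r ∷ R) f-g) = multiple R λ n → begin
        coeff (R *ₚ M) n
          ≡⟨ ℤ.+-identityˡ _ ⟨
        0ℤ ℤ.+ coeff (R *ₚ M) n
          ≈⟨ +-cong (*-congʳ (coeff M (suc n)) r≈0) (≈-reflexive refl) ⟨
        r ℤ.* coeff M (suc n) ℤ.+ coeff (R *ₚ M) n
          ≡⟨ coeff-∷*ₚ r R (suc n) ⟨
        coeff ((r ∷ R) *ₚ M) (suc n)
          ≈⟨ f-g (suc n) ⟩
        f n ℤ.- g n ∎
        where
        open ≈-Reasoning
        m<1+m = ℕ.n<1+n m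
        r≈0 : r ≈ 0ℤ
        r≈0 = x*y≈0⇒x≈0 p-prime (begin
          r ℤ.* coeff M m
            ≡⟨ ℤ.+-identityʳ _ ⟨
          r ℤ.* coeff M m ℤ.+ 0ℤ
            ≈⟨ +-cong {r ℤ.* coeff M m} (≈-reflexive refl) (vanishes-delay (*ₚ-low R) m m<1+m) ⟨
          r ℤ.* coeff M m ℤ.+ delay (coeff (R *ₚ M)) m
            ≡⟨ coeff-∷*ₚ r R m ⟨
          coeff ((r ∷ R) *ₚ M) m
            ≈⟨ f-g m ⟩
          delay f m ℤ.- delay g m
            ≈⟨ x≈y⇒x-y≈0 (≈-trans (vanishes-delay f-low m m<1+m)
                                  (≈-sym (vanishes-delay g-low m m<1+m))) ⟩
          0ℤ ∎) Mₘ≉0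

      -- The factors q are cancelled one at a time; every partial shift still vanishes below `m`, as
      -- `delay-cancel` requires.
      shift-cancel : ∀ k {f g} → VanishesBelow m f → VanishesBelow m g →
        shift k f ≋ shift k g → f ≋ g
      shift-cancel zero    f-low g-low f≋g = f≋g
      shift-cancel (suc k) f-low g-low f≋g = shift-cancel k f-low g-low
        (delay-cancel (shift-low f-low) (shift-low g-low) f≋g)
        where
        shift-low : ∀ {f} → VanishesBelow m f → VanishesBelow m (shift k f)
        shift-low low = vanishes-shift k λ i i+k<m → low i (ℕ.≤-<-trans (ℕ.m≤m+n i k) i+k<m)

-- Reduction of polynomials modulo p

module Reduction (p : ℕ) where
  open 𝔽[q] p

  reduce-+ : ∀ P Q → reduce (P ℕ[q].+ₚ Q) ≡ reduce P +ₚ reduce Q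
  reduce-+ []      Q       = refl
  reduce-+ (a ∷ P) []      = refl
  reduce-+ (a ∷ P) (b ∷ Q) = cong (+ (a ℕ.+ b) ∷_) (reduce-+ P Q)

  reduce-· : ∀ c P → reduce (c ℕ[q].·ₚ P) ≡ + c ·ₚ reduce P
  reduce-· c []      = refl
  reduce-· c (a ∷ P) = cong₂ _∷_ (ℤ.pos-* c a) (reduce-· c P)

  reduce-* : ∀ P Q → reduce (P ℕ[q].*ₚ Q) ≡ reduce P *ₚ reduce Q
  reduce-* []      Q = refl
  reduce-* (a ∷ P) Q = trans (reduce-+ (a ℕ[q].·ₚ Q) _)
    (cong₂ _+ₚ_ (reduce-· a Q) (cong (0ℤ ∷_) (reduce-* P Q)))

  reduce-q^ : ∀ k → reduce (ℕ[q].q^ k) ≡ q^ k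
  reduce-q^ zero    = refl
  reduce-q^ (suc k) = cong (0ℤ ∷_) (reduce-q^ k)

  coeff-q^ : ∀ k → coeff (q^ k) ≗ shift k (coeff (1ℤ ∷ []))
  coeff-q^ zero    n       = refl
  coeff-q^ (suc k) zero    = refl
  coeff-q^ (suc k) (suc n) = coeff-q^ k n

  coeff-q^* : ∀ k P → coeff (q^ k *ₚ P) ≗ shift k (coeff P)
  coeff-q^* zero P n = trans (PolynomialCongruence.coeff-∷*ₚ p P 1ℤ [] n)
    (trans (cong₂ ℤ._+_ (ℤ.*-identityˡ (coeff P n)) (shift-0 1 (λ _ → refl) n)) (ℤ.+-identityʳ _))
  coeff-q^* (suc k) P n = trans (PolynomialCongruence.coeff-∷*ₚ p P 0ℤ (q^ k) n)
    (trans (ℤ.+-identityˡ _) (delay-cong (coeff-q^* k P) n))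

-- Recurrences for q-binomial coefficients at either end of the words

length-∷ʳ : ∀ {a} {A : Set a} (v : List A) b → length (v ∷ʳ b) ≡ suc (length v)
length-∷ʳ v b = trans (length-++ v) (ℕ.+-comm (length v) 1)

module BinomialCoefficients
  (p : ℕ) {a : Level} {A : Set a} (_≟_ : DecidableEquality A) where
  open 𝔽[q] p
  open ValProperties p using (coeff-+; coeff-·)
  open QBinomial _≟_
  open Reduction p

  binomʳ-coeff : List A → List A → Sequence
  binomʳ-coeff u v = coeff (reduce (binomʳ u v))

  binomʳ-[] : ∀ u → binomʳ-coeff u [] ≗ coeff (1ℤ ∷ [])
  binomʳ-[] []      n = refl
  binomʳ-[] (_ ∷ _) n = refl

  binomʳ-∷ : ∀ a u b v → binomʳ-coeff (a ∷ u) (b ∷ v) ≗ λ n →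
    shift (length (b ∷ v)) (binomʳ-coeff u (b ∷ v)) n ℤ.+ + δ a b ℤ.* binomʳ-coeff u v n
  binomʳ-∷ a u b v n = begin
    coeff (reduce (S ℕ[q].+ₚ T)) n
      ≡⟨ cong (λ P → coeff P n) (reduce-+ S T) ⟩
    coeff (reduce S +ₚ reduce T) n
      ≡⟨ coeff-+ (reduce S) (reduce T) n ⟩
    coeff (reduce S) n ℤ.+ coeff (reduce T) n
      ≡⟨ cong₂ (λ P Q → coeff P n ℤ.+ coeff Q n)
           (trans (reduce-* (ℕ[q].q^ l) B) (cong (_*ₚ reduce B) (reduce-q^ l)))
           (reduce-· (δ a b) (binomʳ u v)) ⟩
    coeff (q^ l *ₚ reduce B) n ℤ.+ coeff (+ δ a b ·ₚ reduce (binomʳ u v)) n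
      ≡⟨ cong₂ ℤ._+_ (coeff-q^* l (reduce B) n) (coeff-· (+ δ a b) (reduce (binomʳ u v)) n) ⟩
    shift l (binomʳ-coeff u (b ∷ v)) n ℤ.+ + δ a b ℤ.* binomʳ-coeff u v n ∎
    where
    open ≡-Reasoning
    l = length (b ∷ v)
    B = binomʳ u (b ∷ v)
    S = (ℕ[q].q^ l) ℕ[q].*ₚ B
    T = δ a b ℕ[q].·ₚ binomʳ u v

  binomʳ-short : ∀ u v → length u < length v → ∀ n → binomʳ-coeff u v n ≡ 0ℤ
  binomʳ-short []      (_ ∷ _) _         n = refl
  binomʳ-short (a ∷ u) (b ∷ v) (s≤s u<v) n = begin
    binomʳ-coeff (a ∷ u) (b ∷ v) n
      ≡⟨ binomʳ-∷ a u b v n ⟩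
    shift (suc (length v)) (binomʳ-coeff u (b ∷ v)) n ℤ.+ + δ a b ℤ.* binomʳ-coeff u v n
      ≡⟨ cong₂ (λ x y → x ℤ.+ + δ a b ℤ.* y)
           (shift-0 (suc (length v)) (binomʳ-short u (b ∷ v) (ℕ.m<n⇒m<1+n u<v)) n)
           (binomʳ-short u v u<v n) ⟩
    0ℤ ℤ.+ + δ a b ℤ.* 0ℤ
      ≡⟨ trans (ℤ.+-identityˡ _) (ℤ.*-zeroʳ (+ δ a b)) ⟩
    0ℤ ∎
    where open ≡-Reasoning

  -- Where the truncated subtractions are not genuine, the coefficient is 0.
  shift-exponents : ∀ u b v →
    shift (suc (suc (length v))) (shift (length u ∸ suc (length v)) (binomʳ-coeff u (b ∷ v)))
      ≗ shift (length u ∸ length v) (shift (suc (length v)) (binomʳ-coeff u (b ∷ v)))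
  shift-exponents u b v n with length (b ∷ v) ℕ.≤? length u
  ... | yes l≤u = begin
    shift (suc l) (shift (length u ∸ l) B) n   ≡⟨ shift-+ (suc l) (length u ∸ l) B n ⟨
    shift (suc l ℕ.+ (length u ∸ l)) B n
      ≡⟨ cong (λ k → shift (suc k) B n) (ℕ.m+[n∸m]≡n l≤u) ⟩
    shift (suc (length u)) B n
      ≡⟨ cong (λ k → shift (suc k) B n) (ℕ.m∸n+n≡m (ℕ.<⇒≤ l≤u)) ⟨
    shift (suc (length u ∸ length v ℕ.+ length v)) B n
      ≡⟨ cong (λ k → shift k B n) (ℕ.+-suc (length u ∸ length v) (length v)) ⟨
    shift (length u ∸ length v ℕ.+ l) B n      ≡⟨ shift-+ (length u ∸ length v) l B n ⟩
    shift (length u ∸ length v) (shift l B) n  ∎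
    where
    open ≡-Reasoning
    l = length (b ∷ v)
    B = binomʳ-coeff u (b ∷ v)
  ... | no l≰u = trans
    (shift-0 (suc (suc (length v))) (shift-0 (length u ∸ suc (length v)) B≡0) n)
    (sym (shift-0 (length u ∸ length v) (shift-0 (suc (length v)) B≡0) n))
    where B≡0 = binomʳ-short u (b ∷ v) (ℕ.≰⇒> l≰u)

  -- The defining recurrence acts at the head of the reversed words; this one acts at their tail. In
  -- the induction, expanding at the head and then at the tail yields the same four terms as
  -- expanding in the opposite order.
  binomʳ-∷ʳ : ∀ a u b v → binomʳ-coeff (u ∷ʳ a) (v ∷ʳ b) ≗ λ n →
    binomʳ-coeff u (v ∷ʳ b) n ℤ.+ + δ a b ℤ.* shift (length u ∸ length v) (binomʳ-coeff u v) n
  binomʳ-∷ʳ a [] b [] n = trans (binomʳ-∷ a [] b [] n)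
    (cong (ℤ._+ + δ a b ℤ.* binomʳ-coeff [] [] n) (shift-0 1 (λ _ → refl) n))
  -- Every term vanishes, because the empty word has coefficient 0 at each non-empty word.
  binomʳ-∷ʳ a [] b (c ∷ v) n = trans (binomʳ-∷ a [] c (v ∷ʳ b) n)
    (cong₂ ℤ._+_ (shift-0 (suc (length (v ∷ʳ b))) (λ _ → refl) n)
      (trans (cong (+ δ a c ℤ.*_) (binomʳ-short [] (v ∷ʳ b) v∷ʳb>0 n))
             (trans (ℤ.*-zeroʳ (+ δ a c)) (sym (ℤ.*-zeroʳ (+ δ a b))))))
    where
    v∷ʳb>0 = subst (0 <_) (sym (length-∷ʳ v b)) (s≤s z≤n)
  binomʳ-∷ʳ a (c ∷ u) b [] n = begin
    binomʳ-coeff (c ∷ u ∷ʳ a) (b ∷ []) n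
      ≡⟨ binomʳ-∷ c (u ∷ʳ a) b [] n ⟩
    delay (binomʳ-coeff (u ∷ʳ a) (b ∷ [])) n ℤ.+ δcb ℤ.* binomʳ-coeff (u ∷ʳ a) [] n
      ≡⟨ cong₂ (λ x y → x ℤ.+ δcb ℤ.* y)
           (trans (delay-cong (binomʳ-∷ʳ a u b []) n)
             (trans (delay-zipWith ℤ._+_ refl _ _ n)
               (cong (λ x → delay (binomʳ-coeff u (b ∷ [])) n ℤ.+ x)
                 (delay-map (δab ℤ.*_) (ℤ.*-zeroʳ δab) _ n))))
           -- The coefficient at the empty word is 1 for every first argument, so `u ∷ʳ a` may be
           -- replaced by `u`.
           (trans (binomʳ-[] (u ∷ʳ a) n) (sym (binomʳ-[] u n))) ⟩
    (delay (binomʳ-coeff u (b ∷ [])) n ℤ.+ δab ℤ.* delay (shift (length u) (binomʳ-coeff u [])) n)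
      ℤ.+ δcb ℤ.* binomʳ-coeff u [] n
      ≡⟨ lemma (delay (binomʳ-coeff u (b ∷ [])) n) _ _ ⟩
    (delay (binomʳ-coeff u (b ∷ [])) n ℤ.+ δcb ℤ.* binomʳ-coeff u [] n)
      ℤ.+ δab ℤ.* delay (shift (length u) (binomʳ-coeff u [])) n
      ≡⟨ cong₂ (λ x y → x ℤ.+ δab ℤ.* y) (sym (binomʳ-∷ c u b [] n))
           (shift-cong (suc (length u)) (λ i → trans (binomʳ-[] u i) (sym (binomʳ-[] (c ∷ u) i))) n) ⟩
    binomʳ-coeff (c ∷ u) (b ∷ []) n ℤ.+ δab ℤ.* delay (shift (length u) (binomʳ-coeff (c ∷ u) [])) n ∎
    where
    open ≡-Reasoning
    δab = + δ a b
    δcb = + δ c b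
    lemma : ∀ x y z → (x ℤ.+ y) ℤ.+ z ≡ (x ℤ.+ z) ℤ.+ y
    lemma = solve-∀
  binomʳ-∷ʳ a (c ∷ u) b (d ∷ v) n = begin
    binomʳ-coeff (c ∷ u ∷ʳ a) (d ∷ v ∷ʳ b) n
      ≡⟨ binomʳ-∷ c (u ∷ʳ a) d (v ∷ʳ b) n ⟩
    shift l (binomʳ-coeff (u ∷ʳ a) (d ∷ v ∷ʳ b)) n ℤ.+ δcd ℤ.* binomʳ-coeff (u ∷ʳ a) (v ∷ʳ b) n
      ≡⟨ cong₂ (λ x y → x ℤ.+ δcd ℤ.* y)
           (trans (shift-cong l (binomʳ-∷ʳ a u b (d ∷ v)) n)
             (trans (shift-zipWith ℤ._+_ refl l _ _ n)
               (cong (λ x → shift l S n ℤ.+ x)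
                 (shift-map (δab ℤ.*_) (ℤ.*-zeroʳ δab) l _ n))))
           (binomʳ-∷ʳ a u b v n) ⟩
    (shift l S n ℤ.+ δab ℤ.* shift l (shift (length u ∸ suc (length v)) Y) n)
      ℤ.+ δcd ℤ.* (binomʳ-coeff u (v ∷ʳ b) n ℤ.+ δab ℤ.* shift e W n)
      -- For |v| < |u| both double shifts of `Y` have total exponent |u| + 1; otherwise `Y` is zero.
      ≡⟨ cong (λ x → (shift l S n ℤ.+ δab ℤ.* x)
                ℤ.+ δcd ℤ.* (binomʳ-coeff u (v ∷ʳ b) n ℤ.+ δab ℤ.* shift e W n))
           (trans (cong (λ k → shift (suc k) (shift (length u ∸ suc (length v)) Y) n) (length-∷ʳ v b))
                  (shift-exponents u d v n)) ⟩
    (shift l S n ℤ.+ δab ℤ.* shift e (shift (suc (length v)) Y) n)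
      ℤ.+ δcd ℤ.* (binomʳ-coeff u (v ∷ʳ b) n ℤ.+ δab ℤ.* shift e W n)
      ≡⟨ lemma δab δcd (shift l S n) _ _ _ ⟩
    (shift l S n ℤ.+ δcd ℤ.* binomʳ-coeff u (v ∷ʳ b) n)
      ℤ.+ δab ℤ.* (shift e (shift (suc (length v)) Y) n ℤ.+ δcd ℤ.* shift e W n)
      ≡⟨ cong₂ (λ x y → x ℤ.+ δab ℤ.* y) (sym (binomʳ-∷ c u d (v ∷ʳ b) n))
           (sym (trans (shift-cong e (binomʳ-∷ c u d v) n)
             (trans (shift-zipWith ℤ._+_ refl e _ _ n)
               (cong (λ x → shift e (shift (suc (length v)) Y) n ℤ.+ x)
                 (shift-map (δcd ℤ.*_) (ℤ.*-zeroʳ δcd) e W n))))) ⟩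
    binomʳ-coeff (c ∷ u) (d ∷ v ∷ʳ b) n ℤ.+ δab ℤ.* shift e (binomʳ-coeff (c ∷ u) (d ∷ v)) n ∎
    where
    open ≡-Reasoning
    δab = + δ a b
    δcd = + δ c d
    l = suc (length (v ∷ʳ b))
    e = length u ∸ length v
    S = binomʳ-coeff u (d ∷ v ∷ʳ b)
    Y = binomʳ-coeff u (d ∷ v)
    W = binomʳ-coeff u v
    lemma : ∀ s t x y z w → (x ℤ.+ s ℤ.* y) ℤ.+ t ℤ.* (z ℤ.+ s ℤ.* w)
                          ≡ (x ℤ.+ t ℤ.* z) ℤ.+ s ℤ.* (y ℤ.+ t ℤ.* w)
    lemma = solve-∀

  binom-coeff : List A → List A → Sequence
  binom-coeff u v = coeff (reduce (binom u v))

  binom-coeff-[] : ∀ u → binom-coeff u [] ≗ coeff (1ℤ ∷ [])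
  binom-coeff-[] u = binomʳ-[] (reverse u)

  binom-coeff-short : ∀ u v → length u < length v → ∀ n → binom-coeff u v n ≡ 0ℤ
  binom-coeff-short u v u<v = binomʳ-short (reverse u) (reverse v)
    (subst₂ _<_ (sym (length-reverse u)) (sym (length-reverse v)) u<v)

  binom-coeff-∷ʳ : ∀ a u b v → binom-coeff (u ∷ʳ a) (v ∷ʳ b) ≗ λ n →
    shift (suc (length v)) (binom-coeff u (v ∷ʳ b)) n ℤ.+ + δ a b ℤ.* binom-coeff u v n
  binom-coeff-∷ʳ a u b v n
    rewrite sym (length-reverse v) | reverse-++ u (a ∷ []) | reverse-++ v (b ∷ [])
    = binomʳ-∷ a (reverse u) b (reverse v) n

  -- Reversal turns the first letters into last letters, so `binomʳ-∷ʳ` applies.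
  binom-coeff-∷ : ∀ a u b v → binom-coeff (a ∷ u) (b ∷ v) ≗ λ n →
    binom-coeff u (b ∷ v) n ℤ.+ + δ a b ℤ.* shift (length u ∸ length v) (binom-coeff u v) n
  binom-coeff-∷ a u b v n
    rewrite sym (length-reverse u) | sym (length-reverse v) | unfold-reverse a u | unfold-reverse b v
    = binomʳ-∷ʳ a (reverse u) b (reverse v) n

-- Valuations as vanishing of low coefficients

module Valuation (p : ℕ) where
  open 𝔽[q] p
  open ValProperties p using (lowZero⇒≤val; ≤val⇒lowZero; _≈0)
  open Residues p

  -- The scan for the valuation must stop at or before the given nonzero coefficient, and it stops
  -- at a nonzero one. Applied to `M`, this provides the exponent of the q-part.
  val-finite : ∀ P n → ¬ coeff P n ≈0 → ∃ λ m → val P ≡ [ m ] × ¬ coeff P m ≈0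
  val-finite []      n       Pₙ≉0 = contradiction (p∣x-y (≈-reflexive {0ℤ} refl)) Pₙ≉0
  val-finite (a ∷ P) n       Pₙ≉0 with + p ℤ.∣? a ℤ.- 0ℤ
  val-finite (a ∷ P) n       Pₙ≉0 | no  a≉0 = 0 , refl , a≉0
  val-finite (a ∷ P) zero    Pₙ≉0 | yes a≈0 = contradiction a≈0 Pₙ≉0
  val-finite (a ∷ P) (suc n) Pₙ≉0 | yes a≈0 with val-finite P n Pₙ≉0
  ... | m , val≡m , Pₘ≉0 =
    suc m , trans (cong (_∔ 1) val≡m) (cong [_] (ℕ.+-comm m 1)) , Pₘ≉0

  below-val : ∀ {m} P → val P ≡ [ m ] → VanishesBelow m (coeff P)
  below-val {m} P val≡m n n<m =
    mod (≤val⇒lowZero m P (subst ([ m ] ≤⁺_) (sym val≡m) [ ℕ.≤-refl ]) n n<m)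

  -- To be used with `j` = |v| and `k` = |w|, so that condition (iii) becomes a statement on
  -- coefficients free of subtraction.
  ≤val∔⇒vanishes : ∀ P m j k → [ m ] ∔ j ≤⁺ val P ∔ k →
    ∀ n → n ℕ.+ k < m ℕ.+ j → coeff P n ≈ 0ℤ
  ≤val∔⇒vanishes P m j k m+j≤ n n+k< =
    mod (≤val⇒lowZero (suc n) P (bound (val P) m+j≤) n (ℕ.n<1+n n))
    where
    bound : ∀ x → [ m ] ∔ j ≤⁺ x ∔ k → [ suc n ] ≤⁺ x
    bound [ l ] [ m+j≤l+k ] = [ ℕ.+-cancelʳ-< k n l (ℕ.<-≤-trans n+k< m+j≤l+k) ]
    bound ⊤⁺    _           = _ ≤⊤⁺

  vanishes⇒≤val∔ : ∀ P m j k → (∀ n → n ℕ.+ k < m ℕ.+ j → coeff P n ≈ 0ℤ) →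
    [ m ] ∔ j ≤⁺ val P ∔ k
  vanishes⇒≤val∔ P m j k P≈0 = bound (val P) (lowZero⇒≤val (m ℕ.+ j ∸ k) P
    (λ n n< → p∣x-y (P≈0 n
      -- An `n` below `m ℕ.+ j ∸ k` exists only if the subtraction is not truncated, which gives `k`
      -- ≤ `m ℕ.+ j`.
      (ℕ.m≤o∸n⇒m+n≤o (suc n) (ℕ.<⇒≤ (ℕ.m∸n≢0⇒n<m (ℕ.m<n⇒n≢0 n<))) n<))))
    where
    bound : ∀ x → [ m ℕ.+ j ∸ k ] ≤⁺ x → [ m ] ∔ j ≤⁺ x ∔ k
    bound [ l ] [ m+j∸k≤l ] =
      [ subst (m ℕ.+ j ≤_) (ℕ.+-comm k l) (ℕ.≤-trans (ℕ.m≤n+m∸n _ k) (ℕ.+-monoʳ-≤ k m+j∸k≤l)) ]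
    bound ⊤⁺    _           = _ ≤⊤⁺

-- Factors with an end letter removed

factor-∷⁻ : ∀ {a} {A : Set a} {u v : List A} {b} → Factor u (b ∷ v) → Factor u v
factor-∷⁻ {v = v} {b} (x , s , u≡) = x ∷ʳ b , s , trans u≡ (sym (++-assoc x (b ∷ []) (v ++ s)))

factor-∷ʳ⁻ : ∀ {a} {A : Set a} {u v : List A} {b} → Factor u (v ∷ʳ b) → Factor u v
factor-∷ʳ⁻ {v = v} {b} (x , s , u≡) = x , b ∷ s , trans u≡ (cong (x ++_) (++-assoc v (b ∷ []) s))

-- The relation of the theorem in terms of coefficient sequences

module CongruenceOfWord
  {a : Level} {A : Set a} {k : ℕ} (finite : A ↔ Fin k) (p : ℕ) (p-prime : Prime p)
  (u : List A) (M : 𝔽[q].Poly p) (m : ℕ)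
  (val≡m : 𝔽[q].val p M ≡ [ m ]) (Mₘ≉0 : ¬ ValProperties._≈0 p (𝔽[q].coeff p M m))
  where
  open 𝔽[q] p
  open WordRelations finite p
  open Residues p
  open PolynomialCongruence p M
  open Reduction p
  open Valuation p
  open BinomialCoefficients p (inj⇒≟ (↔⇒↣ finite))

  M-low : VanishesBelow m (coeff M)
  M-low = below-val M val≡m

  one : Sequence
  one = coeff (1ℤ ∷ [])

  -- The product S(w,v) = q^(|w|-|v|) binom(w,v). Truncation of the exponent is harmless: when |w| <
  -- |v| the coefficient is zero.
  shifted-binom : List A → List A → Sequence
  shifted-binom w v = shift (length w ∸ length v) (binom-coeff w v)

  -- Divisibility of S(w,v) by q^m without subtraction, as `large⇒shifted-low` and
  -- `shifted-low⇒large` confirm.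
  Large : List A → List A → Set
  Large w v = ∀ n → n ℕ.+ length w < m ℕ.+ length v → binom-coeff w v n ≈ 0ℤ

  LargeFactors : List A → Set a
  LargeFactors w = ∀ v b → Factor u (b ∷ v) → Large w v

  record _≃_ (w₁ w₂ : List A) : Set a where
    field
      factors : ∀ v → Factor u v → binom-coeff w₁ v ≋ binom-coeff w₂ v
      lengths : shift (length w₁) one ≋ shift (length w₂) one
      large   : length w₁ ≡ length w₂ ⊎ (LargeFactors w₁ × LargeFactors w₂)
  open _≃_

  LargeVal⇒LargeFactors : ∀ w → LargeVal u M w → LargeFactors w
  LargeVal⇒LargeFactors w lv v b f = ≤val∔⇒vanishes (binomₚ w v) m (length v) (length w)
    (subst (λ x → x ∔ length v ≤⁺ val (binomₚ w v) ∔ length w) val≡m (lv v b f))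

  LargeFactors⇒LargeVal : ∀ w → LargeFactors w → LargeVal u M w
  LargeFactors⇒LargeVal w lf v b f =
    subst (λ x → x ∔ length v ≤⁺ val (binomₚ w v) ∔ length w) (sym val≡m)
      (vanishes⇒≤val∔ (binomₚ w v) m (length v) (length w) (lf v b f))

  ≅⇒≃ : ∀ w₁ w₂ → w₁ ≅[ u , M ] w₂ → w₁ ≃ w₂
  ≅⇒≃ w₁ w₂ (i , ii , iii) = record
    { factors = λ v f → mod⇒≋ (binomₚ w₁ v) (binomₚ w₂ v) (i v f)
    ; lengths = begin
        shift (length w₁) one    ≈⟨ ≗⇒≋ (coeff-q^ (length w₁)) ⟨
        coeff (q^ length w₁)     ≈⟨ mod⇒≋ (q^ length w₁) (q^ length w₂) ii ⟩
        coeff (q^ length w₂)     ≈⟨ ≗⇒≋ (coeff-q^ (length w₂)) ⟩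
        shift (length w₂) one    ∎
    ; large   = map₂ (map× (LargeVal⇒LargeFactors w₁) (LargeVal⇒LargeFactors w₂)) iii
    }
    where open ≋-Reasoning

  ≃⇒≅ : ∀ {w₁ w₂} → w₁ ≃ w₂ → w₁ ≅[ u , M ] w₂
  ≃⇒≅ {w₁} {w₂} w₁≃w₂ =
      (λ v f → ≋⇒mod (binomₚ w₁ v) (binomₚ w₂ v) (factors w₁≃w₂ v f))
    , ≋⇒mod (q^ length w₁) (q^ length w₂) (begin
        coeff (q^ length w₁)     ≈⟨ ≗⇒≋ (coeff-q^ (length w₁)) ⟩
        shift (length w₁) one    ≈⟨ lengths w₁≃w₂ ⟩
        shift (length w₂) one    ≈⟨ ≗⇒≋ (coeff-q^ (length w₂)) ⟨
        coeff (q^ length w₂)     ∎)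
    , map₂ (map× (LargeFactors⇒LargeVal w₁) (LargeFactors⇒LargeVal w₂)) (large w₁≃w₂)
    where open ≋-Reasoning

  -- Equivalence relation

  -- For transitivity when one of the two relations comes with equal lengths. If |v| ≤ |w₂|, the
  -- indices concerned lie below `m`, where congruence modulo `M` preserves coefficients; otherwise
  -- the coefficient is zero.
  large-transfer : ∀ w₁ w₂ v → length w₁ ≡ length w₂ →
    binom-coeff w₁ v ≋ binom-coeff w₂ v → Large w₁ v → Large w₂ v
  large-transfer w₁ w₂ v |w₁|≡|w₂| B₁≋B₂ large₁ n n+|w₂|< with length v ℕ.≤? length w₂
  ... | no  |v|≰|w₂| = ≈-reflexive (binom-coeff-short w₂ v (ℕ.≰⇒> |v|≰|w₂|) n)
  ... | yes |v|≤|w₂| = ≈-trans (≈-sym (≋⇒≈-below M-low B₁≋B₂ n n<m))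
          (large₁ n (subst (λ l → n ℕ.+ l < m ℕ.+ length v) (sym |w₁|≡|w₂|) n+|w₂|<))
    where
    n<m = ℕ.+-cancelʳ-< (length v) n m (ℕ.≤-<-trans (ℕ.+-monoʳ-≤ n |v|≤|w₂|) n+|w₂|<)

  largeFactors-transfer : ∀ w₁ w₂ → length w₁ ≡ length w₂ →
    (∀ v → Factor u v → binom-coeff w₁ v ≋ binom-coeff w₂ v) → LargeFactors w₁ → LargeFactors w₂
  largeFactors-transfer w₁ w₂ |w₁|≡|w₂| B₁≋B₂ large₁ v b f =
    large-transfer w₁ w₂ v |w₁|≡|w₂| (B₁≋B₂ v (factor-∷⁻ f)) (large₁ v b f)

  ≃-refl : ∀ {w} → w ≃ w
  ≃-refl = record
    { factors = λ _ _ → ≗⇒≋ (λ _ → refl) ; lengths = ≗⇒≋ (λ _ → refl) ; large = inj₁ refl }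

  ≃-sym : ∀ {w₁ w₂} → w₁ ≃ w₂ → w₂ ≃ w₁
  ≃-sym e = record
    { factors = λ v f → ≋-sym (factors e v f)
    ; lengths = ≋-sym (lengths e)
    ; large   = map⊎ sym swap (large e)
    }

  ≃-trans : ∀ {w₁ w₂ w₃} → w₁ ≃ w₂ → w₂ ≃ w₃ → w₁ ≃ w₃
  ≃-trans {w₁} {w₂} {w₃} e e′ = record
    { factors = λ v f → ≋-trans (factors e v f) (factors e′ v f)
    ; lengths = ≋-trans (lengths e) (lengths e′)
    ; large   = larges (large e) (large e′)
    }
    where
    larges : length w₁ ≡ length w₂ ⊎ (LargeFactors w₁ × LargeFactors w₂) →
             length w₂ ≡ length w₃ ⊎ (LargeFactors w₂ × LargeFactors w₃) →
             length w₁ ≡ length w₃ ⊎ (LargeFactors w₁ × LargeFactors w₃)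
    larges (inj₁ l₁≡l₂)    (inj₁ l₂≡l₃)    = inj₁ (trans l₁≡l₂ l₂≡l₃)
    larges (inj₁ l₁≡l₂)    (inj₂ (L₂ , L₃)) =
      inj₂ (largeFactors-transfer w₂ w₁ (sym l₁≡l₂) (factors (≃-sym e)) L₂ , L₃)
    larges (inj₂ (L₁ , L₂)) (inj₁ l₂≡l₃)    =
      inj₂ (L₁ , largeFactors-transfer w₂ w₃ l₂≡l₃ (factors e′) L₂)
    larges (inj₂ (L₁ , _)) (inj₂ (_ , L₃)) = inj₂ (L₁ , L₃)

  -- Stability under concatenation

  -- The coefficient at the empty word is always 1, so a longer word only leaves fewer indices to
  -- check.
  large-[] : ∀ w w′ → length w ≤ length w′ → Large w [] → Large w′ []
  large-[] w w′ w≤w′ large n n+|w′|< =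
    ≈-trans (≈-reflexive (trans (binom-coeff-[] w′ n) (sym (binom-coeff-[] w n))))
      (large n (ℕ.≤-<-trans (ℕ.+-monoʳ-≤ n w≤w′) n+|w′|<))

  -- In the recurrence at the first letter, the first term keeps `d ∷ v` while the word gets
  -- shorter, which relaxes the bound. In the second term both lengths drop by one, and the shift
  -- reads only indices up to `n`.
  largeFactors-∷ : ∀ c w → LargeFactors w → LargeFactors (c ∷ w)
  largeFactors-∷ c w large []      b f = large-[] w (c ∷ w) (ℕ.n≤1+n _) (large [] b f)
  largeFactors-∷ c w large (d ∷ v) b f n n+< =
    ≈-trans (≈-reflexive (binom-coeff-∷ c w d v n))
      (+*-vanishes (+ δ c d)
        (large (d ∷ v) b f n (ℕ.<-trans (ℕ.+-monoʳ-< n (ℕ.n<1+n _)) n+<))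
        (shift-vanishes (length w ∸ length v) n λ i i≤n → large v d (factor-∷⁻ f) i
          (ℕ.≤-<-trans (ℕ.+-monoˡ-≤ (length w) i≤n)
            (ℕ.s<s⁻¹ (subst₂ _<_ (ℕ.+-suc n (length w)) (ℕ.+-suc m (length v)) n+<)))))

  -- The same count with the recurrence at the last letter. Removing the last letter of `v` keeps
  -- the letter `b` in front, so the shorter word again has a left extension in `u`.
  largeFactors-∷ʳ : ∀ c w → LargeFactors w → LargeFactors (w ∷ʳ c)
  largeFactors-∷ʳ c w large v b f with initLast v
  ... | [] = large-[] w (w ∷ʳ c)
    (subst (length w ≤_) (sym (length-∷ʳ w c)) (ℕ.n≤1+n _)) (large [] b f)
  ... | v′ ∷ʳ′ d = λ n n+< →
    let n+|w|<m+|v′| = ℕ.s<s⁻¹ (subst₂ _<_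
          (trans (cong (n ℕ.+_) (length-∷ʳ w c)) (ℕ.+-suc n (length w)))
          (trans (cong (m ℕ.+_) (length-∷ʳ v′ d)) (ℕ.+-suc m (length v′))) n+<)
        m+|v′|≤ = ℕ.+-monoʳ-≤ m (subst (length v′ ≤_) (sym (length-∷ʳ v′ d)) (ℕ.n≤1+n _))
    in ≈-trans (≈-reflexive (binom-coeff-∷ʳ c w d v′ n))
      (+*-vanishes (+ δ c d)
        (shift-vanishes (suc (length v′)) n λ i i≤n → large (v′ ∷ʳ d) b f i
          (ℕ.≤-<-trans (ℕ.+-monoˡ-≤ (length w) i≤n) (ℕ.<-≤-trans n+|w|<m+|v′| m+|v′|≤)))
        (large v′ b (factor-∷ʳ⁻ f) n n+|w|<m+|v′|))

  large⇒shifted-low : ∀ w v → Large w v → VanishesBelow m (shifted-binom w v)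
  large⇒shifted-low w v large = vanishes-shift (length w ∸ length v) λ n n+< →
    large n (ℕ.≤-<-trans
      (subst (n ℕ.+ length w ≤_) (sym (ℕ.+-assoc n _ (length v)))
        (ℕ.+-monoʳ-≤ n (subst (length w ≤_) (ℕ.+-comm (length v) _)
          (ℕ.m≤n+m∸n (length w) (length v)))))
      (ℕ.+-monoˡ-< (length v) n+<))

  shifted-low⇒large : ∀ w v → VanishesBelow m (shifted-binom w v) → Large w v
  shifted-low⇒large w v low n n+|w|< with length v ℕ.≤? length w
  ... | no  |v|≰|w| = ≈-reflexive (binom-coeff-short w v (ℕ.≰⇒> |v|≰|w|) n)
  ... | yes |v|≤|w| = ≈-trans (≈-reflexive (sym (shift-lookup e (binom-coeff w v) n))) (low (e ℕ.+ n)
    (ℕ.+-cancelʳ-< (length v) (e ℕ.+ n) m (subst (_< m ℕ.+ length v) (sym e+n+|v|≡n+|w|) n+|w|<)))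
    where
    open ≡-Reasoning
    e = length w ∸ length v
    e+n+|v|≡n+|w| : e ℕ.+ n ℕ.+ length v ≡ n ℕ.+ length w
    e+n+|v|≡n+|w| = begin
      e ℕ.+ n ℕ.+ length v     ≡⟨ cong (ℕ._+ length v) (ℕ.+-comm e n) ⟩
      n ℕ.+ e ℕ.+ length v     ≡⟨ ℕ.+-assoc n e (length v) ⟩
      n ℕ.+ (e ℕ.+ length v)   ≡⟨ cong (n ℕ.+_) (ℕ.m∸n+n≡m |v|≤|w|) ⟩
      n ℕ.+ length w           ∎

  -- Multiplication by q^|v| replaces the truncated exponent by |w|, to which (ii) applies.
  shift-shifted : ∀ w v → shift (length v) (shifted-binom w v) ≗ shift (length w) (binom-coeff w v)
  shift-shifted w v n with length v ℕ.≤? length w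
  ... | yes |v|≤|w| = trans (sym (shift-+ (length v) (length w ∸ length v) (binom-coeff w v) n))
                            (cong (λ i → shift i (binom-coeff w v) n) (ℕ.m+[n∸m]≡n |v|≤|w|))
  ... | no  |v|≰|w| = trans (shift-0 (length v) (shift-0 (length w ∸ length v) B≡0) n)
                            (sym (shift-0 (length w) B≡0 n))
    where B≡0 = binom-coeff-short w v (ℕ.≰⇒> |v|≰|w|)

  -- This controls the second term of the recurrence at the first letter. Equal lengths give equal
  -- exponents; otherwise both sides are divisible by q^m, so the congruence may be proved after
  -- multiplication by q^|v|.
  ≃⇒shifted-≋ : ∀ {w₁ w₂} → w₁ ≃ w₂ → ∀ v b → Factor u (b ∷ v) →
    shifted-binom w₁ v ≋ shifted-binom w₂ v
  ≃⇒shifted-≋ {w₁} {w₂} e v b f with large e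
  ... | inj₁ |w₁|≡|w₂| = subst
    (λ l → shift (l ∸ length v) (binom-coeff w₁ v) ≋ shifted-binom w₂ v) (sym |w₁|≡|w₂|)
    (≋-shift (length w₂ ∸ length v) (factors e v (factor-∷⁻ f)))
  ... | inj₂ (large₁ , large₂) = shift-cancel M-low p-prime (λ (mod d) → Mₘ≉0 d) (length v)
    (large⇒shifted-low w₁ v (large₁ v b f)) (large⇒shifted-low w₂ v (large₂ v b f)) (begin
      shift (length v) (shifted-binom w₁ v)   ≈⟨ ≗⇒≋ (shift-shifted w₁ v) ⟩
      shift (length w₁) (binom-coeff w₁ v)    ≈⟨ ≋-shift (length w₁) (factors e v (factor-∷⁻ f)) ⟩
      shift (length w₁) (binom-coeff w₂ v)
        ≈⟨ shift-≋⇒shift*-≋ (length w₁) (length w₂) (lengths e) (binomₚ w₂ v) ⟩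
      shift (length w₂) (binom-coeff w₂ v)    ≈⟨ ≗⇒≋ (shift-shifted w₂ v) ⟨
      shift (length v) (shifted-binom w₂ v)   ∎)
    where open ≋-Reasoning

  binom-coeff-[]-≋ : ∀ w₁ w₂ → binom-coeff w₁ [] ≋ binom-coeff w₂ []
  binom-coeff-[]-≋ w₁ w₂ = ≗⇒≋ (λ n → trans (binom-coeff-[] w₁ n) (sym (binom-coeff-[] w₂ n)))

  ≃-∷ : ∀ c {w₁ w₂} → w₁ ≃ w₂ → (c ∷ w₁) ≃ (c ∷ w₂)
  ≃-∷ c {w₁} {w₂} e = record
    { factors = prepended
    ; lengths = ≋-delay (lengths e)
    ; large   = map⊎ (cong suc) (map× (largeFactors-∷ c w₁) (largeFactors-∷ c w₂)) (large e)
    }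
    where
    open ≋-Reasoning
    prepended : ∀ v → Factor u v → binom-coeff (c ∷ w₁) v ≋ binom-coeff (c ∷ w₂) v
    prepended []      f = binom-coeff-[]-≋ (c ∷ w₁) (c ∷ w₂)
    prepended (b ∷ v) f = begin
      binom-coeff (c ∷ w₁) (b ∷ v)
        ≈⟨ ≗⇒≋ (binom-coeff-∷ c w₁ b v) ⟩
      (λ n → binom-coeff w₁ (b ∷ v) n ℤ.+ + δ c b ℤ.* shifted-binom w₁ v n)
        ≈⟨ ≋-+ (factors e (b ∷ v) f) (≋-* (+ δ c b) (≃⇒shifted-≋ e v b f)) ⟩
      (λ n → binom-coeff w₂ (b ∷ v) n ℤ.+ + δ c b ℤ.* shifted-binom w₂ v n)
        ≈⟨ ≗⇒≋ (binom-coeff-∷ c w₂ b v) ⟨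
      binom-coeff (c ∷ w₂) (b ∷ v) ∎

  -- At the last letter the exponent of q depends only on `v`, so for the coefficients condition (i)
  -- suffices.
  ≃-∷ʳ : ∀ c {w₁ w₂} → w₁ ≃ w₂ → (w₁ ∷ʳ c) ≃ (w₂ ∷ʳ c)
  ≃-∷ʳ c {w₁} {w₂} e = record
    { factors = appended
    ; lengths = subst₂ (λ j l → shift j one ≋ shift l one)
        (sym (length-∷ʳ w₁ c)) (sym (length-∷ʳ w₂ c)) (≋-delay (lengths e))
    ; large   = map⊎
        (λ l₁≡l₂ → trans (length-∷ʳ w₁ c) (trans (cong suc l₁≡l₂) (sym (length-∷ʳ w₂ c))))
        (map× (largeFactors-∷ʳ c w₁) (largeFactors-∷ʳ c w₂)) (large e)
    }
    where
    open ≋-Reasoning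
    appended : ∀ v → Factor u v → binom-coeff (w₁ ∷ʳ c) v ≋ binom-coeff (w₂ ∷ʳ c) v
    appended v f with initLast v
    ... | []       = binom-coeff-[]-≋ (w₁ ∷ʳ c) (w₂ ∷ʳ c)
    ... | v′ ∷ʳ′ b = begin
      binom-coeff (w₁ ∷ʳ c) (v′ ∷ʳ b)
        ≈⟨ ≗⇒≋ (binom-coeff-∷ʳ c w₁ b v′) ⟩
      (λ n → shift (suc (length v′)) (binom-coeff w₁ (v′ ∷ʳ b)) n ℤ.+ + δ c b ℤ.* binom-coeff w₁ v′ n)
        ≈⟨ ≋-+ (≋-shift (suc (length v′)) (factors e (v′ ∷ʳ b) f))
               (≋-* (+ δ c b) (factors e v′ (factor-∷ʳ⁻ f))) ⟩
      (λ n → shift (suc (length v′)) (binom-coeff w₂ (v′ ∷ʳ b)) n ℤ.+ + δ c b ℤ.* binom-coeff w₂ v′ n)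
        ≈⟨ ≗⇒≋ (binom-coeff-∷ʳ c w₂ b v′) ⟨
      binom-coeff (w₂ ∷ʳ c) (v′ ∷ʳ b) ∎

  ≃-++ˡ : ∀ x {w₁ w₂} → w₁ ≃ w₂ → (x ++ w₁) ≃ (x ++ w₂)
  ≃-++ˡ []      e = e
  ≃-++ˡ (c ∷ x) e = ≃-∷ c (≃-++ˡ x e)

  ≃-++ʳ : ∀ x {w₁ w₂} → w₁ ≃ w₂ → (w₁ ++ x) ≃ (w₂ ++ x)
  ≃-++ʳ []      {w₁} {w₂} e = subst₂ _≃_ (sym (++-identityʳ w₁)) (sym (++-identityʳ w₂)) e
  ≃-++ʳ (c ∷ x) {w₁} {w₂} e = subst₂ _≃_ (++-assoc w₁ (c ∷ []) x) (++-assoc w₂ (c ∷ []) x)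
    (≃-++ʳ x (≃-∷ʳ c e))

  ≅-isCongruence : IsCongruence (λ w₁ w₂ → w₁ ≅[ u , M ] w₂)
  ≅-isCongruence = record
    { isEquivalence = record
      { refl  = λ {w} → ≃⇒≅ (≃-refl {w})
      ; sym   = λ {w₁} {w₂} e → ≃⇒≅ (≃-sym (≅⇒≃ w₁ w₂ e))
      ; trans = λ {w₁} {w₂} {w₃} e e′ → ≃⇒≅ (≃-trans (≅⇒≃ w₁ w₂ e) (≅⇒≃ w₂ w₃ e′))
      }
    ; ++-congˡ = λ {x} {w₁} {w₂} e → ≃⇒≅ (≃-++ˡ x (≅⇒≃ w₁ w₂ e))
    ; ++-congʳ = λ {x} {w₁} {w₂} e → ≃⇒≅ (≃-++ʳ x (≅⇒≃ w₁ w₂ e))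
    }

  -- Every congruence refining the coefficient relation satisfies (ii) and (iii)

  δ-refl : ∀ b → δ b b ≡ 1
  δ-refl b = cong (λ d → if d then 1 else 0) (dec-true (inj⇒≟ (↔⇒↣ finite) b b) refl)

  -- The recurrence at the first letter solved for S(w,v): prepending the same letter `b` to both
  -- words makes the Kronecker delta 1.
  shifted-binom-difference : ∀ b w v → shifted-binom w v ≗ λ n →
    binom-coeff (b ∷ w) (b ∷ v) n ℤ.+ -1ℤ ℤ.* binom-coeff w (b ∷ v) n
  shifted-binom-difference b w v n = begin
    shifted-binom w v n
      ≡⟨ lemma (binom-coeff w (b ∷ v) n) _ ⟨
    (B ℤ.+ 1ℤ ℤ.* shifted-binom w v n) ℤ.+ -1ℤ ℤ.* B
      ≡⟨ cong (λ d → (B ℤ.+ + d ℤ.* shifted-binom w v n) ℤ.+ -1ℤ ℤ.* B) (δ-refl b) ⟨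
    (B ℤ.+ + δ b b ℤ.* shifted-binom w v n) ℤ.+ -1ℤ ℤ.* B
      ≡⟨ cong (ℤ._+ -1ℤ ℤ.* B) (binom-coeff-∷ b w b v n) ⟨
    binom-coeff (b ∷ w) (b ∷ v) n ℤ.+ -1ℤ ℤ.* B ∎
    where
    open ≡-Reasoning
    B = binom-coeff w (b ∷ v) n
    lemma : ∀ x y → (x ℤ.+ 1ℤ ℤ.* y) ℤ.+ -1ℤ ℤ.* x ≡ y
    lemma = solve-∀

  -- With B the common residue of the two coefficients, the hypotheses say that
  -- q^(|w₁|-|v|) B ≡ q^(|w₂|-|v|) B modulo q^m, and |w₁| < |w₂|.
  shorter⇒large : ∀ w₁ w₂ v → length w₁ < length w₂ →
    binom-coeff w₁ v ≋ binom-coeff w₂ v → shifted-binom w₁ v ≋ shifted-binom w₂ v →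
    Large w₁ v × Large w₂ v
  shorter⇒large w₁ w₂ v w₁<w₂ B₁≋B₂ S₁≋S₂ =
      shifted-low⇒large w₁ v low₁
    , shifted-low⇒large w₂ v (λ n n<m → ≈-trans (≈-sym (≋⇒≈-below M-low S₁≋S₂ n n<m)) (low₁ n n<m))
    where
    d = length w₂ ∸ suc (length w₁)

    exponents : length v ≤ length w₁ →
      length w₂ ∸ length v ≡ suc d ℕ.+ (length w₁ ∸ length v)
    exponents v≤w₁ = begin
      length w₂ ∸ length v                     ≡⟨ cong (_∸ length v) (ℕ.m∸n+n≡m w₁<w₂) ⟨
      d ℕ.+ suc (length w₁) ∸ length v         ≡⟨ cong (_∸ length v) (ℕ.+-suc d (length w₁)) ⟩
      suc d ℕ.+ length w₁ ∸ length v           ≡⟨ ℕ.+-∸-assoc (suc d) v≤w₁ ⟩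
      suc d ℕ.+ (length w₁ ∸ length v)         ∎
      where open ≡-Reasoning

    S₁≋shift-S₁ : length v ≤ length w₁ → shifted-binom w₁ v ≋ shift (suc d) (shifted-binom w₁ v)
    S₁≋shift-S₁ v≤w₁ = begin
      shifted-binom w₁ v                                         ≈⟨ S₁≋S₂ ⟩
      shift (length w₂ ∸ length v) (binom-coeff w₂ v)            ≈⟨ ≋-shift (length w₂ ∸ length v) B₁≋B₂ ⟨
      shift (length w₂ ∸ length v) (binom-coeff w₁ v)
        ≈⟨ ≗⇒≋ (λ n → cong (λ i → shift i (binom-coeff w₁ v) n) (exponents v≤w₁)) ⟩
      shift (suc d ℕ.+ (length w₁ ∸ length v)) (binom-coeff w₁ v)
        ≈⟨ ≗⇒≋ (shift-+ (suc d) (length w₁ ∸ length v) (binom-coeff w₁ v)) ⟩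
      shift (suc d) (shifted-binom w₁ v)                         ∎
      where open ≋-Reasoning

    low₁ : VanishesBelow m (shifted-binom w₁ v)
    low₁ with length v ℕ.≤? length w₁
    ... | yes v≤w₁ = vanishes-geometric d m (≋⇒≈-below M-low (S₁≋shift-S₁ v≤w₁))
    ... | no  v≰w₁ = λ n _ → ≈-reflexive
      (shift-0 (length w₁ ∸ length v) (binom-coeff-short w₁ v (ℕ.≰⇒> v≰w₁)) n)

  module _ {ℓ} (R : Rel (List A) ℓ) (R-congruence : IsCongruence R)
    (R⇒∼ : ∀ {w₁ w₂} → R w₁ w₂ → w₁ ∼[ u , M ] w₂) where

    factors-≋ : ∀ {w₁ w₂} → R w₁ w₂ → ∀ v → Factor u v → binom-coeff w₁ v ≋ binom-coeff w₂ v
    factors-≋ {w₁} {w₂} r v f = mod⇒≋ (binomₚ w₁ v) (binomₚ w₂ v) (R⇒∼ r v f)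

    -- Compatibility with prepending `b` relates `b ∷ w₁` to `b ∷ w₂`, and both coefficients in the
    -- difference are taken at the factor `b ∷ v` of `u`.
    shifted-≋ : ∀ {w₁ w₂} → R w₁ w₂ → ∀ v b → Factor u (b ∷ v) →
      shifted-binom w₁ v ≋ shifted-binom w₂ v
    shifted-≋ {w₁} {w₂} r v b f = begin
      shifted-binom w₁ v
        ≈⟨ ≗⇒≋ (shifted-binom-difference b w₁ v) ⟩
      (λ n → binom-coeff (b ∷ w₁) (b ∷ v) n ℤ.+ -1ℤ ℤ.* binom-coeff w₁ (b ∷ v) n)
        ≈⟨ ≋-+ (factors-≋ (IsCongruence.++-congˡ R-congruence {b ∷ []} r) (b ∷ v) f)
               (≋-* -1ℤ (factors-≋ r (b ∷ v) f)) ⟩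
      (λ n → binom-coeff (b ∷ w₂) (b ∷ v) n ℤ.+ -1ℤ ℤ.* binom-coeff w₂ (b ∷ v) n)
        ≈⟨ ≗⇒≋ (shifted-binom-difference b w₂ v) ⟨
      shifted-binom w₂ v ∎
      where open ≋-Reasoning

    R⇒large : ∀ {w₁ w₂} → R w₁ w₂ → length w₁ < length w₂ → LargeFactors w₁ × LargeFactors w₂
    R⇒large {w₁} {w₂} r w₁<w₂ =
      (λ v b f → proj₁ (both v b f)) , (λ v b f → proj₂ (both v b f))
      where
      both : ∀ v b → Factor u (b ∷ v) → Large w₁ v × Large w₂ v
      both v b f = shorter⇒large w₁ w₂ v w₁<w₂ (factors-≋ r v (factor-∷⁻ f)) (shifted-≋ r v b f)

    R⇒≃ : u ≢ [] → ∀ {w₁ w₂} → R w₁ w₂ → w₁ ≃ w₂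
    R⇒≃ u≢[] {w₁} {w₂} r = record
      { factors = factors-≋ r
      ; lengths = q^-lengths (first u u≢[])
      ; large   = larges
      }
      where
      open ≋-Reasoning

      -- A non-empty `u` has a one-letter factor, which makes the empty word admissible as `v` in
      -- `shifted-≋`.
      first : ∀ u′ → u′ ≢ [] → ∃ λ b → Factor u′ (b ∷ [])
      first []       u′≢[] = contradiction refl u′≢[]
      first (b ∷ u′) _     = b , [] , u′ , refl

      q^-lengths : (∃ λ b → Factor u (b ∷ [])) → shift (length w₁) one ≋ shift (length w₂) one
      q^-lengths (b , f) = begin
        shift (length w₁) one   ≈⟨ ≗⇒≋ (shift-cong (length w₁) (binom-coeff-[] w₁)) ⟨
        shifted-binom w₁ []     ≈⟨ shifted-≋ r [] b f ⟩
        shifted-binom w₂ []     ≈⟨ ≗⇒≋ (shift-cong (length w₂) (binom-coeff-[] w₂)) ⟩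
        shift (length w₂) one   ∎

      larges : length w₁ ≡ length w₂ ⊎ (LargeFactors w₁ × LargeFactors w₂)
      larges with ℕ.<-cmp (length w₁) (length w₂)
      ... | tri≈ _ l₁≡l₂ _ = inj₁ l₁≡l₂
      ... | tri< l₁<l₂ _ _ = inj₂ (R⇒large r l₁<l₂)
      -- Symmetry of `R` puts the shorter word first, as `R⇒large` expects.
      ... | tri> _ _ l₂<l₁ = inj₂ (swap (R⇒large (R-sym r) l₂<l₁))
        where R-sym = IsEquivalence.sym (IsCongruence.isEquivalence R-congruence)

proposition6p12 : {a ℓ : Level} {A : Set a} {k : ℕ} (finite : A ↔ Fin k)
    (p : ℕ) → Prime p →
    (u : List A) → u ≢ [] →
    (M : 𝔽[q].Poly p) (d : ℕ) → 𝔽[q].HasDegree p M d → 1 ≤ d →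
    let open WordRelations finite p in
    IsCongruence (λ w₁ w₂ → w₁ ≅[ u , M ] w₂)
    × IsCoarsestCongruenceRefining ℓ (λ w₁ w₂ → w₁ ∼[ u , M ] w₂) (λ w₁ w₂ → w₁ ≅[ u , M ] w₂)
proposition6p12 finite p p-prime u u≢[] M d (M-d≉0 , _) _
  -- The leading coefficient is nonzero, so the valuation of `M` is a natural number.
  with Valuation.val-finite p M d M-d≉0
... | m , val≡m , Mₘ≉0 = ≅-isCongruence , record
  { isCongruence = ≅-isCongruence
  ; refines      = proj₁
  ; coarsest     = λ R R-congruence R⇒∼ r → ≃⇒≅ (R⇒≃ R R-congruence R⇒∼ u≢[] r)
  }
  where open CongruenceOfWord finite p p-prime u M m val≡m Mₘ≉0
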